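{- Given a c.e. transitive relation $\prec$ on $\omega$ and a c.e. set $U\subseteq\omega$, one can effectively obtain (uniformly in indices for $\prec$ and $U$) a c.e. transitive relation $\sqsubset$ on $\omega$ such that $\mathcal{I}(\sqsubset)$ is computably homeomorphic to the effective space obtained from $\mathcal{I}(\prec)$ by adding the set $A=\{I\in\mathcal{I}(\prec)\mid (\forall x\in U)\, x\notin I\}$ as a c.e. open set to its topology.
   Context: For a transitive relation $\prec$ on $\omega$, an ideal is a non-empty set $I\subseteq\omega$ which is a lower set ($b\prec a\in I\Rightarrow b\in I$) and directed (for $a,b\in I$ there is $c\in I$ with $a\prec c$, $b\prec c$). $\mathcal{I}(\prec)$ is the space of all ideals with topology generated by $[n]_\prec=\{I\mid n\in I\}$, an effective space with base numbering $n\mapsto[n]_\prec$. Adding $A$ as a c.e. open set means taking the topology generated by the sets $[n]_\prec$ together with $A$, with the effective base consisting of the sets $[n]_\prec$ and $A\cap[n]_\prec$. Effective spaces are countably based $T_0$ spaces with a numbered base whose pairwise intersections are uniformly c.e. unions of basic sets; a map is computable if preimages of basic open sets are uniformly c.e. unions of basic open sets, and a computable homeomorphism is a homeomorphism computable in both directions. -}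

module Defs where

open import Data.Bool.Base using (Bool; true; false)
open import Data.Nat.Base using (ℕ; zero; suc; _<_)
open import Data.Nat.Properties using (<-cmp)
open import Data.Product.Base using (_×_; _,_; proj₁; proj₂; ∃; ∃₂; Σ-syntax)
open import Function.Base using (_∘_)
open import Function.Bundles using (_⇔_; mk⇔; Equivalence; Inverse)
open import Level using (Level; 0ℓ) renaming (suc to lsuc)
open import Relation.Binary.Bundles using (Setoid)
open import Relation.Binary.Core using (Rel)
open import Relation.Binary.Definitions using (Transitive; tri<; tri≈; tri>; _Respects_)
open import Relation.Binary.PropositionalEquality using (_≡_; refl; sym; cong; cong₂; subst)
open import Relation.Nullary.Negation using (¬_)
open import Relation.Unary using (Pred; _∈_; _∉_; _∩_; _≐_; Satisfiable)

private variable
  ℓ : Level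

------------------------------------------------------------------------
-- Partial recursive functions
--
-- The model of computation is the class of partial recursive functions
-- on binary trees (Lisp-style S-expressions): projections, pairing,
-- composition, primitive recursion on trees and minimisation.  Numbers
-- are the trees  num n ; restricted to these, recᶜ and μ are ordinary
-- primitive recursion and minimisation, so that the functions on ω
-- obtained are the usual partial recursive ones.

data Tree : Set where
  leaf : Tree
  node : (l r : Tree) → Tree

num : ℕ → Tree
num zero    = leaf
num (suc n) = node leaf (num n)

infixr 9 _∘ᶜ_
infix  4 _·_⇓_ _↓_

data Code : Set where
  idᶜ leafᶜ fstᶜ sndᶜ : Code
  ⟨_,_⟩               : (f g : Code) → Code
  _∘ᶜ_                : (f g : Code) → Code
  recᶜ                : (z s : Code) → Code
  μ                   : (f : Code) → Code

-- c · x ⇓ y : the program c halts on input x with output y.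

data _·_⇓_ : Code → Tree → Tree → Set where
  ⇓id   : ∀ {x} → idᶜ · x ⇓ x
  ⇓leaf : ∀ {x} → leafᶜ · x ⇓ leaf
  ⇓fst₀ : fstᶜ · leaf ⇓ leaf
  ⇓fst  : ∀ {l r} → fstᶜ · node l r ⇓ l
  ⇓snd₀ : sndᶜ · leaf ⇓ leaf
  ⇓snd  : ∀ {l r} → sndᶜ · node l r ⇓ r
  ⇓pair : ∀ {f g x y z} → f · x ⇓ y → g · x ⇓ z → ⟨ f , g ⟩ · x ⇓ node y z
  ⇓comp : ∀ {f g x y z} → g · x ⇓ y → f · y ⇓ z → f ∘ᶜ g · x ⇓ z
  -- recursion on the right component, the left one being a parameter
  ⇓rec₀ : ∀ {z s x y} → z · x ⇓ y → recᶜ z s · node x leaf ⇓ y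
  ⇓rec  : ∀ {z s x l r u v y} →
          recᶜ z s · node x l ⇓ u → recᶜ z s · node x r ⇓ v →
          s · node x (node (node l r) (node u v)) ⇓ y →
          recᶜ z s · node x (node l r) ⇓ y
  -- the least n at which f takes the value leaf
  ⇓μ    : ∀ {f x} n → f · node x (num n) ⇓ leaf →
          (∀ {i} → i < n → ∃₂ λ l r → f · node x (num i) ⇓ node l r) →
          μ f · x ⇓ num n

_↓_ : Code → Tree → Set
c ↓ x = ∃ λ y → c · x ⇓ y

⌜_⌝ : Code → Tree
⌜ idᶜ ⌝       = node (num 0) leaf
⌜ leafᶜ ⌝     = node (num 1) leaf
⌜ fstᶜ ⌝      = node (num 2) leaf
⌜ sndᶜ ⌝      = node (num 3) leaf
⌜ ⟨ f , g ⟩ ⌝ = node (num 4) (node ⌜ f ⌝ ⌜ g ⌝)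
⌜ f ∘ᶜ g ⌝    = node (num 5) (node ⌜ f ⌝ ⌜ g ⌝)
⌜ recᶜ z s ⌝  = node (num 6) (node ⌜ z ⌝ ⌜ s ⌝)
⌜ μ f ⌝       = node (num 7) ⌜ f ⌝

-- An index of a computable function or of a c.e. set is a program.

Computable₂ : (Code → Code → Code) → Set
Computable₂ f = Σ[ p ∈ Code ] ∀ d e → p · node ⌜ d ⌝ ⌜ e ⌝ ⇓ ⌜ f d e ⌝

-- The unary, binary and ternary c.e. relations on ω with index e.

W₁ : Code → Pred ℕ 0ℓ
W₁ e n = e ↓ num n

W₂ : Code → Rel ℕ 0ℓ
W₂ e m n = e ↓ node (num m) (num n)

W₃ : Code → ℕ → ℕ → Pred ℕ 0ℓ
W₃ e k m n = e ↓ node (num k) (node (num m) (num n))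

------------------------------------------------------------------------
-- Effective spaces

⋃[_] : {X : Set ℓ} → Pred ℕ 0ℓ → (ℕ → Pred X 0ℓ) → Pred X 0ℓ
⋃[ S ] B x = ∃ λ n → n ∈ S × x ∈ B n

-- Points are taken up to the equality of the setoid.  The topology
-- consists of the unions of the sets  Base n .

record EffectiveSpace : Set₂ where
  field
    points : Setoid (lsuc 0ℓ) 0ℓ
  open Setoid points public using (Carrier; _≈_)
  field
    Base      : ℕ → Pred Carrier 0ℓ
    Base-resp : ∀ n → Base n Respects _≈_
    T₀        : ∀ {x y} → (∀ n → x ∈ Base n ⇔ y ∈ Base n) → x ≈ y
    cover     : ∀ x → ∃ λ n → x ∈ Base n
    ∩-index   : Code
    ∩-Base    : ∀ i j → Base i ∩ Base j ≐ ⋃[ W₃ ∩-index i j ] Base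

  Open : Pred Carrier 0ℓ → Set₁
  Open P = Σ[ S ∈ Pred ℕ 0ℓ ] P ≐ ⋃[ S ] Base

module _ (X Y : EffectiveSpace) where
  private
    module X = EffectiveSpace X
    module Y = EffectiveSpace Y

  Continuous : (X.Carrier → Y.Carrier) → Set₁
  Continuous f = ∀ {P} → Y.Open P → X.Open (P ∘ f)

  Computable : (X.Carrier → Y.Carrier) → Set₁
  Computable f = Σ[ e ∈ Code ] ∀ n → Y.Base n ∘ f ≐ ⋃[ W₂ e n ] X.Base

  computable⇒continuous : ∀ f → Computable f → Continuous f
  computable⇒continuous f (e , pre) (S , P⊆ , ⊆P) =
    (λ m → ∃ λ n → n ∈ S × W₂ e n m) ,
    (λ p → let n , n∈S , fx∈n = P⊆ p ; m , e↓ , x∈m = proj₁ (pre n) fx∈n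
           in m , (n , n∈S , e↓) , x∈m) ,
    (λ (m , (n , n∈S , e↓) , x∈m) → ⊆P (n , n∈S , proj₂ (pre n) (m , e↓ , x∈m)))

-- Continuity of both maps is automatic by computable⇒continuous.

record ComputableHomeomorphism (X Y : EffectiveSpace) : Set₁ where
  field
    bijection : Inverse (EffectiveSpace.points X) (EffectiveSpace.points Y)
  open Inverse bijection public using (to; from)
  field
    to-computable   : Computable X Y to
    from-computable : Computable Y X from

------------------------------------------------------------------------
-- Spaces of ideals

record Ideal (_≺_ : Rel ℕ 0ℓ) : Set₁ where
  field
    Member   : Pred ℕ 0ℓ
    nonempty : Satisfiable Member
    lower    : ∀ {a b} → b ≺ a → a ∈ Member → b ∈ Member
    directed : ∀ {a b} → a ∈ Member → b ∈ Member →
               ∃ λ c → c ∈ Member × a ≺ c × b ≺ c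

open Ideal public using (Member)

idealSetoid : Rel ℕ 0ℓ → Setoid (lsuc 0ℓ) 0ℓ
idealSetoid _≺_ = record
  { Carrier       = Ideal _≺_
  ; _≈_           = λ I J → Member I ≐ Member J
  ; isEquivalence = record
    { refl  = (λ i → i) , (λ i → i)
    ; sym   = λ (f , g) → g , f
    ; trans = λ (f , g) (f′ , g′) → (λ i → f′ (f i)) , (λ i → g (g′ i))
    }
  }

idealSpace : Code → EffectiveSpace
idealSpace e = record
  { points    = idealSetoid (W₂ e)
  ; Base      = λ n I → n ∈ Member I
  ; Base-resp = λ n (f , _) → f
  ; T₀        = λ h → (λ {n} → Equivalence.to (h n)) , (λ {n} → Equivalence.from (h n))
  ; cover     = Ideal.nonempty
  ; ∩-index   = upper
  ; ∩-Base    = λ i j →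
      (λ {I} (i∈I , j∈I) →
        let c , c∈I , (_ , i≺c) , (_ , j≺c) = Ideal.directed I i∈I j∈I in
        c , (_ , ⇓pair (⇓comp (⇓pair ⇓fst (⇓comp ⇓snd ⇓snd)) i≺c)
                       (⇓comp (⇓pair (⇓comp ⇓snd ⇓fst) (⇓comp ⇓snd ⇓snd)) j≺c))
          , c∈I) ,
      (λ { {I} (c , (_ , ⇓pair (⇓comp (⇓pair ⇓fst (⇓comp ⇓snd ⇓snd)) i≺c)
                               (⇓comp (⇓pair (⇓comp ⇓snd ⇓fst) (⇓comp ⇓snd ⇓snd)) j≺c))
              , c∈I) →
        Ideal.lower I (_ , i≺c) c∈I , Ideal.lower I (_ , j≺c) c∈I })
  }
  where
  -- halts on (i , j , c) iff i ≺ c and j ≺ c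
  upper : Code
  upper = ⟨ e ∘ᶜ ⟨ fstᶜ , sndᶜ ∘ᶜ sndᶜ ⟩ , e ∘ᶜ ⟨ fstᶜ ∘ᶜ sndᶜ , sndᶜ ∘ᶜ sndᶜ ⟩ ⟩

------------------------------------------------------------------------
-- Adding a set to the topology

-- The bijection ω ≅ 2 × ω sending 2m to (false , m) and 2m+1 to
-- (true , m).

next : Bool × ℕ → Bool × ℕ
next (false , m) = true , m
next (true  , m) = false , suc m

halve : ℕ → Bool × ℕ
halve zero    = false , zero
halve (suc n) = next (halve n)

double : ℕ → ℕ
double zero    = zero
double (suc m) = suc (suc (double m))

halve-double : ∀ m → halve (double m) ≡ (false , m)
halve-double zero    = refl
halve-double (suc m) = cong (next ∘ next) (halve-double m)

halve-onto : ∀ b m → ∃ λ n → halve n ≡ (b , m)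
halve-onto false m = double m , halve-double m
halve-onto true  m = suc (double m) , cong next (halve-double m)

det : ∀ {c x y z} → c · x ⇓ y → c · x ⇓ z → y ≡ z
det ⇓id ⇓id = refl
det ⇓leaf ⇓leaf = refl
det ⇓fst₀ ⇓fst₀ = refl
det ⇓fst ⇓fst = refl
det ⇓snd₀ ⇓snd₀ = refl
det ⇓snd ⇓snd = refl
det (⇓pair p q) (⇓pair p′ q′) = cong₂ node (det p p′) (det q q′)
det (⇓comp p q) (⇓comp p′ q′) with refl ← det p p′ = det q q′
det (⇓rec₀ p) (⇓rec₀ p′) = det p p′
det (⇓rec p q r) (⇓rec p′ q′ r′) with refl ← det p p′ | refl ← det q q′ = det r r′
det (⇓μ n p h) (⇓μ n′ p′ h′) with <-cmp n n′
... | tri≈ _ refl _ = refl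
... | tri< n<n′ _ _ with _ , _ , q ← h′ n<n′ with () ← det p q
... | tri> _ _ n′<n with _ , _ , q ← h n′<n with () ← det q p′

-- if c outputs leaf then t else e, where t and e must both halt
ifLeaf : Code → Code → Code → Code
ifLeaf c t e = recᶜ t (e ∘ᶜ fstᶜ) ∘ᶜ ⟨ idᶜ , c ⟩

rec↓ : ∀ {t e x a b} v → t · x ⇓ a → e · x ⇓ b → recᶜ t (e ∘ᶜ fstᶜ) ↓ node x v
rec↓ leaf       t⇓ e⇓ = _ , ⇓rec₀ t⇓
rec↓ (node l r) t⇓ e⇓ =
  _ , ⇓rec (proj₂ (rec↓ l t⇓ e⇓)) (proj₂ (rec↓ r t⇓ e⇓)) (⇓comp ⇓fst e⇓)

⇓if-leaf : ∀ {c t e x a} → c · x ⇓ leaf → t · x ⇓ a → ifLeaf c t e · x ⇓ a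
⇓if-leaf c⇓ t⇓ = ⇓comp (⇓pair ⇓id c⇓) (⇓rec₀ t⇓)

⇓if-node : ∀ {c t e x l r a b} → c · x ⇓ node l r → t · x ⇓ a → e · x ⇓ b →
           ifLeaf c t e · x ⇓ b
⇓if-node {l = l} {r} c⇓ t⇓ e⇓ =
  ⇓comp (⇓pair ⇓id c⇓)
    (⇓rec (proj₂ (rec↓ l t⇓ e⇓)) (proj₂ (rec↓ r t⇓ e⇓)) (⇓comp ⇓fst e⇓))

-- halts exactly on leaf
isLeaf : Code
isLeaf = μ fstᶜ

isLeaf↓ : isLeaf ↓ leaf
isLeaf↓ = _ , ⇓μ 0 ⇓fst λ ()

isLeaf↑ : ∀ {l r} → ¬ isLeaf ↓ node l r
isLeaf↑ (_ , ⇓μ n () _)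

flag : Bool → Tree
flag false = num 0
flag true  = num 1

pairTree : Bool × ℕ → Tree
pairTree (b , m) = node (flag b) (num m)

oneᶜ sucᶜ nextᶜ halveᶜ : Code
oneᶜ   = ⟨ leafᶜ , leafᶜ ⟩
sucᶜ   = ⟨ leafᶜ , idᶜ ⟩
nextᶜ  = ifLeaf fstᶜ ⟨ oneᶜ , sndᶜ ⟩ ⟨ leafᶜ , sucᶜ ∘ᶜ sndᶜ ⟩
halveᶜ = recᶜ ⟨ leafᶜ , leafᶜ ⟩ (nextᶜ ∘ᶜ sndᶜ ∘ᶜ sndᶜ ∘ᶜ sndᶜ) ∘ᶜ ⟨ leafᶜ , idᶜ ⟩

⇓next : ∀ p → nextᶜ · pairTree p ⇓ pairTree (next p)
⇓next (false , m) = ⇓if-leaf ⇓fst (⇓pair (⇓pair ⇓leaf ⇓leaf) ⇓snd)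
⇓next (true  , m) = ⇓if-node ⇓fst (⇓pair (⇓pair ⇓leaf ⇓leaf) ⇓snd)
                      (⇓pair ⇓leaf (⇓comp ⇓snd (⇓pair ⇓leaf ⇓id)))

⇓halve : ∀ n → halveᶜ · num n ⇓ pairTree (halve n)
⇓halve n = ⇓comp (⇓pair ⇓leaf ⇓id) (go n)
  where
  go : ∀ n → recᶜ ⟨ leafᶜ , leafᶜ ⟩ (nextᶜ ∘ᶜ sndᶜ ∘ᶜ sndᶜ ∘ᶜ sndᶜ) · node leaf (num n)
             ⇓ pairTree (halve n)
  go zero    = ⇓rec₀ (⇓pair ⇓leaf ⇓leaf)
  go (suc n) = ⇓rec (⇓rec₀ (⇓pair ⇓leaf ⇓leaf)) (go n)
                 (⇓comp (⇓comp (⇓comp ⇓snd ⇓snd) ⇓snd) (⇓next (halve n)))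

arg₁ arg₂ arg₃ : Code
arg₁ = halveᶜ ∘ᶜ fstᶜ
arg₂ = halveᶜ ∘ᶜ fstᶜ ∘ᶜ sndᶜ
arg₃ = halveᶜ ∘ᶜ sndᶜ ∘ᶜ sndᶜ

indicesᶜ testᶜ : Code
indicesᶜ = ⟨ sndᶜ ∘ᶜ arg₁ , ⟨ sndᶜ ∘ᶜ arg₂ , sndᶜ ∘ᶜ arg₃ ⟩ ⟩
testᶜ    = ifLeaf (fstᶜ ∘ᶜ arg₃) (ifLeaf (fstᶜ ∘ᶜ arg₁) (fstᶜ ∘ᶜ arg₂) oneᶜ) leafᶜ

triple : ℕ → ℕ → ℕ → Tree
triple i j k = node (num i) (node (num j) (num k))

index : ℕ → ℕ
index = proj₂ ∘ halve

test : Bool → Bool → Bool → Bool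
test p     q true  = false
test false q false = q
test true  q false = true

module _ (i j k : ℕ) where
  ⇓arg₁ : arg₁ · triple i j k ⇓ pairTree (halve i)
  ⇓arg₁ = ⇓comp ⇓fst (⇓halve i)

  ⇓arg₂ : arg₂ · triple i j k ⇓ pairTree (halve j)
  ⇓arg₂ = ⇓comp (⇓comp ⇓snd ⇓fst) (⇓halve j)

  ⇓arg₃ : arg₃ · triple i j k ⇓ pairTree (halve k)
  ⇓arg₃ = ⇓comp (⇓comp ⇓snd ⇓snd) (⇓halve k)

  ⇓indices : indicesᶜ · triple i j k ⇓ triple (index i) (index j) (index k)
  ⇓indices = ⇓pair (⇓comp ⇓arg₁ ⇓snd) (⇓pair (⇓comp ⇓arg₂ ⇓snd) (⇓comp ⇓arg₃ ⇓snd))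

  ⇓test : testᶜ · triple i j k ⇓
          flag (test (proj₁ (halve i)) (proj₁ (halve j)) (proj₁ (halve k)))
  ⇓test = outer (proj₁ (halve i)) (proj₁ (halve j)) (proj₁ (halve k))
            (⇓comp ⇓arg₁ ⇓fst) (⇓comp ⇓arg₂ ⇓fst) (⇓comp ⇓arg₃ ⇓fst)
    where
    inner : ∀ p q → fstᶜ ∘ᶜ arg₁ · triple i j k ⇓ flag p →
            fstᶜ ∘ᶜ arg₂ · triple i j k ⇓ flag q →
            ifLeaf (fstᶜ ∘ᶜ arg₁) (fstᶜ ∘ᶜ arg₂) oneᶜ · triple i j k ⇓ flag (test p q false)
    inner false q p⇓ q⇓ = ⇓if-leaf p⇓ q⇓
    inner true  q p⇓ q⇓ = ⇓if-node p⇓ q⇓ (⇓pair ⇓leaf ⇓leaf)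

    outer : ∀ p q r → fstᶜ ∘ᶜ arg₁ · triple i j k ⇓ flag p →
            fstᶜ ∘ᶜ arg₂ · triple i j k ⇓ flag q →
            fstᶜ ∘ᶜ arg₃ · triple i j k ⇓ flag r →
            testᶜ · triple i j k ⇓ flag (test p q r)
    outer p q false p⇓ q⇓ r⇓ = ⇓if-leaf r⇓ (inner p q p⇓ q⇓)
    outer p q true  p⇓ q⇓ r⇓ = ⇓if-node r⇓ (inner p q p⇓ q⇓) ⇓leaf

-- halts on (i , j , k) iff w halts on the triple of their halves and
-- k is odd if one of i, j is
adjoin-index : Code → Code
adjoin-index w = ⟨ w ∘ᶜ indicesᶜ , isLeaf ∘ᶜ testᶜ ⟩

adjoin-W₃ : ∀ w i j k → W₃ (adjoin-index w) i j k ⇔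
  (W₃ w (index i) (index j) (index k) ×
   test (proj₁ (halve i)) (proj₁ (halve j)) (proj₁ (halve k)) ≡ false)
adjoin-W₃ w i j k = mk⇔
  (λ { (_ , ⇓pair (⇓comp v⇓ w⇓) (⇓comp t⇓ l⇓)) →
    (_ , subst (λ v → w · v ⇓ _) (det v⇓ (⇓indices i j k)) w⇓) ,
    halts _ (_ , subst (λ t → isLeaf · t ⇓ _) (det t⇓ (⇓test i j k)) l⇓) })
  (λ ((_ , w⇓) , eq) →
    _ , ⇓pair (⇓comp (⇓indices i j k) w⇓)
          (⇓comp (subst (λ b → testᶜ · triple i j k ⇓ flag b) eq (⇓test i j k)) (proj₂ isLeaf↓)))
  where
  halts : ∀ b → isLeaf ↓ flag b → b ≡ false
  halts false _  = refl
  halts true  l↓ with () ← isLeaf↑ l↓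

module _ (X : EffectiveSpace) (A : Pred (EffectiveSpace.Carrier X) 0ℓ)
         (A-resp : ∀ x y → EffectiveSpace._≈_ X x y → x ∈ A → y ∈ A) where
  private
    module X = EffectiveSpace X

  restrict : Bool → Pred X.Carrier 0ℓ → Pred X.Carrier 0ℓ
  restrict false P = P
  restrict true  P = A ∩ P

  adjoinBase : ℕ → Pred X.Carrier 0ℓ
  adjoinBase n = let b , m = halve n in restrict b (X.Base m)

  private
    restrict-∩ : ∀ {P Q x} p q → x ∈ restrict p P → x ∈ restrict q Q →
                 ∃ λ r → test p q r ≡ false ×
                         x ∈ P × x ∈ Q × (∀ {R} → x ∈ R → x ∈ restrict r R)
    restrict-∩ false false x∈P x∈Q = false , refl , x∈P , x∈Q , λ z → z
    restrict-∩ false true  x∈P (a , x∈Q) = true , refl , x∈P , x∈Q , (a ,_)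
    restrict-∩ true  false (a , x∈P) x∈Q = true , refl , x∈P , x∈Q , (a ,_)
    restrict-∩ true  true  (a , x∈P) (_ , x∈Q) = true , refl , x∈P , x∈Q , (a ,_)

    restrict-⊆ : ∀ {P x} r → x ∈ restrict r P → x ∈ P
    restrict-⊆ false x∈P       = x∈P
    restrict-⊆ true  (_ , x∈P) = x∈P

    restrict-join : ∀ {P Q R x} p q r → test p q r ≡ false → x ∈ restrict r R →
                    x ∈ P → x ∈ Q → x ∈ restrict p P × x ∈ restrict q Q
    restrict-join false false r    _  _       x∈P x∈Q = x∈P , x∈Q
    restrict-join false true  true _  (a , _) x∈P x∈Q = x∈P , a , x∈Q
    restrict-join true  false true _  (a , _) x∈P x∈Q = (a , x∈P) , x∈Q
    restrict-join true  true  true _  (a , _) x∈P x∈Q = (a , x∈P) , (a , x∈Q)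

    restrict-resp : ∀ {P} b → P Respects X._≈_ → restrict b P Respects X._≈_
    restrict-resp false P-resp x≈y x∈P       = P-resp x≈y x∈P
    restrict-resp true  P-resp x≈y (a , x∈P) = A-resp _ _ x≈y a , P-resp x≈y x∈P

    plain : ∀ m → ∃ λ n → adjoinBase n ≡ X.Base m
    plain m = let n , eq = halve-onto false m
              in n , cong (λ (b , m) → restrict b (X.Base m)) eq

    ∩-⊆ : ∀ i j {x} → x ∈ adjoinBase i ∩ adjoinBase j →
          x ∈ ⋃[ W₃ (adjoin-index X.∩-index) i j ] adjoinBase
    ∩-⊆ i j {x} (x∈i , x∈j)
      with r , ok , x∈P , x∈Q , f ← restrict-∩ (proj₁ (halve i)) (proj₁ (halve j)) x∈i x∈j
      with m , w↓ , x∈m ← proj₁ (X.∩-Base (index i) (index j)) (x∈P , x∈Q)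
      with k , eq ← halve-onto r m
      = k , Equivalence.from (adjoin-W₃ X.∩-index i j k)
              ( subst (λ h → W₃ X.∩-index (index i) (index j) (proj₂ h)) (sym eq) w↓
              , subst (λ h → test (proj₁ (halve i)) (proj₁ (halve j)) (proj₁ h) ≡ false) (sym eq) ok)
          , subst (λ (b , m) → x ∈ restrict b (X.Base m)) (sym eq) (f {X.Base m} x∈m)

    ∩-⊇ : ∀ i j {x} → x ∈ ⋃[ W₃ (adjoin-index X.∩-index) i j ] adjoinBase →
          x ∈ adjoinBase i ∩ adjoinBase j
    ∩-⊇ i j (k , k∈ , x∈k)
      with w↓ , ok ← Equivalence.to (adjoin-W₃ X.∩-index i j k) k∈
      with x∈P , x∈Q ← proj₂ (X.∩-Base (index i) (index j))
                         (index k , w↓ , restrict-⊆ (proj₁ (halve k)) x∈k)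
      = restrict-join (proj₁ (halve i)) (proj₁ (halve j)) (proj₁ (halve k)) ok x∈k x∈P x∈Q

  -- The space X with A added as a c.e. open set:
  -- Base (2m) = X.Base m  and  Base (2m+1) = A ∩ X.Base m.

  adjoin : EffectiveSpace
  adjoin = record
    { points    = X.points
    ; Base      = adjoinBase
    ; Base-resp = λ n → restrict-resp (proj₁ (halve n)) (X.Base-resp (index n))
    ; T₀        = λ {x} {y} h → X.T₀ λ m → let n , eq = plain m in
                    subst (λ P → x ∈ P ⇔ y ∈ P) eq (h n)
    ; cover     = λ x → let m , x∈m = X.cover x ; n , eq = plain m in
                    n , subst (x ∈_) (sym eq) x∈m
    ; ∩-index   = adjoin-index X.∩-index
    ; ∩-Base    = λ i j → ∩-⊆ i j , ∩-⊇ i j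
    }

------------------------------------------------------------------------
-- The ideals containing no element of the c.e. set with index u

Avoiding : ∀ _≺_ → Code → Pred (Ideal _≺_) 0ℓ
Avoiding _≺_ u I = ∀ x → x ∈ W₁ u → x ∉ Member I

Avoiding-resp : ∀ _≺_ u (I J : Ideal _≺_) → Member I ≐ Member J →
                I ∈ Avoiding _≺_ u → J ∈ Avoiding _≺_ u
Avoiding-resp _≺_ u I J (_ , J⊆I) avoid x x∈U x∈J = avoid x x∈U (J⊆I x∈J)

-- Passing to the topology generated by A makes the closed set A clopen, so the new
-- space is the disjoint sum of A and its complement, the union of the sets [x] for
-- x ∈ U.  A number p codes a tag, telling to which summand p belongs, a finite set
-- and a stage.  Put p ⊏ q if the stage increases, the set of p is contained in the
-- set of q, some element of q is seen at the stage of q to be above all elements of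
-- p, and q contains everything below its stage that is seen at that stage to be
-- below an element of p; moreover, at the stage of q, no element of q has been
-- enumerated into U (tag 0), or some element of p has (tag 1).  As the sets are
-- finite, all of this is decidable, including the negative condition.  An ideal I of ≺
-- corresponds to the ideal of all p whose set is a subset of I, with the tag that
-- fits; an ideal of ⊏ corresponds to the union of its sets, which is in A in the
-- case of tag 0 because the stages along an ideal of ⊏ are unbounded.
--
-- Stages are implemented by a program transformation  bounded , which bounds all
-- minimisations of a program by an additional input.

{-# OPTIONS --safe #-}
module Submission where

open import Defs
open import Axiom.ExcludedMiddle using (ExcludedMiddle)
open import Data.Bool.Base using (Bool; true; false; if_then_else_)
open import Data.Fin.Base using (Fin; zero; suc)
open import Data.Nat.Base using (ℕ; zero; suc; pred; _+_; _∸_; _⊔_; _≤_; _<_; z≤n; s≤s)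
open import Data.Nat.GeneralisedArithmetic using (fold)
open import Data.Nat.Properties
open import Data.Product.Base using (_×_; _,_; proj₁; proj₂; ∃; ∃₂; Σ-syntax; map₁; map₂; swap)
open import Data.Sum.Base using (inj₁; inj₂; [_,_]′)
open import Data.Vec.Base using (Vec; []; _∷_; lookup)
open import Function.Base using (_∘_; id; const)
open import Function.Bundles using (_⇔_; mk⇔; Equivalence; Inverse)
open import Level using (0ℓ)
open import Relation.Binary.Core using (Rel)
open import Relation.Binary.Definitions using (Transitive)
open import Relation.Binary.PropositionalEquality
  using (_≡_; refl; sym; trans; cong; cong₂; subst)
open import Relation.Nullary using (¬_; yes; no; contradiction; decidable-stable)
open import Relation.Unary using (Pred; _∈_; _≐_)

open Equivalence using () renaming (to to ⇒; from to ⇐)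

-- Total programs with two holes

infixr 9 _⊙_

-- Minimisation is absent, so every term denotes a total function. A term can be instantiated to a
-- program, evaluated on trees and quoted as a code.
data Term : Set where
  hole                    : Bool → Term
  id′ leaf′ fst′ snd′     : Term
  pair _⊙_                : (f g : Term) → Term
  rec                     : (z s f g : Term) → Term

pick : ∀ {a} {A : Set a} → A → A → Bool → A
pick x y b = if b then y else x

inst : (Bool → Code) → Term → Code
inst ρ (hole b)      = ρ b
inst ρ id′           = idᶜ
inst ρ leaf′         = leafᶜ
inst ρ fst′          = fstᶜ
inst ρ snd′          = sndᶜ
inst ρ (pair f g)    = ⟨ inst ρ f , inst ρ g ⟩
inst ρ (f ⊙ g)       = inst ρ f ∘ᶜ inst ρ g
inst ρ (rec z s f g) = recᶜ (inst ρ z) (inst ρ s) ∘ᶜ ⟨ inst ρ f , inst ρ g ⟩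

left right : Tree → Tree
left leaf        = leaf
left (node l _)  = l
right leaf       = leaf
right (node _ r) = r

foldTree : (z s : Tree → Tree) → Tree → Tree → Tree
foldTree z s x leaf         = z x
foldTree z s x t@(node l r) = s (node x (node t (node (foldTree z s x l) (foldTree z s x r))))

eval : (Bool → Tree → Tree) → Term → Tree → Tree
eval σ (hole b)      x = σ b x
eval σ id′           x = x
eval σ leaf′         x = leaf
eval σ fst′          x = left x
eval σ snd′          x = right x
eval σ (pair f g)    x = node (eval σ f x) (eval σ g x)
eval σ (f ⊙ g)       x = eval σ f (eval σ g x)
eval σ (rec z s f g) x = foldTree (eval σ z) (eval σ s) (eval σ f x) (eval σ g x)

module _ {ρ : Bool → Code} {σ : Bool → Tree → Tree} (ρ⇓σ : ∀ b x → ρ b · x ⇓ σ b x) where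

  inst-⇓ : ∀ t x → inst ρ t · x ⇓ eval σ t x
  foldTree-⇓ : ∀ z s x t → recᶜ (inst ρ z) (inst ρ s) · node x t ⇓
               foldTree (eval σ z) (eval σ s) x t

  inst-⇓ (hole b)      x          = ρ⇓σ b x
  inst-⇓ id′           x          = ⇓id
  inst-⇓ leaf′         x          = ⇓leaf
  inst-⇓ fst′          leaf       = ⇓fst₀
  inst-⇓ fst′          (node l r) = ⇓fst
  inst-⇓ snd′          leaf       = ⇓snd₀
  inst-⇓ snd′          (node l r) = ⇓snd
  inst-⇓ (pair f g)    x          = ⇓pair (inst-⇓ f x) (inst-⇓ g x)
  inst-⇓ (f ⊙ g)       x          = ⇓comp (inst-⇓ g x) (inst-⇓ f _)
  inst-⇓ (rec z s f g) x          =
    ⇓comp (⇓pair (inst-⇓ f x) (inst-⇓ g x)) (foldTree-⇓ z s (eval σ f x) (eval σ g x))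

  foldTree-⇓ z s x leaf       = ⇓rec₀ (inst-⇓ z x)
  foldTree-⇓ z s x (node l r) =
    ⇓rec (foldTree-⇓ z s x l) (foldTree-⇓ z s x r) (inst-⇓ s _)

-- Quotation of terms as codes

constant : Tree → Term
constant leaf       = leaf′
constant (node l r) = pair (constant l) (constant r)

-- Builds the code of an instance, with `π` reading the codes of the fillers off the input. As `rec`
-- unfolds to a composition with a pairing, it takes the tags 5, 6 and 4.
quote′ : (Bool → Term) → Term → Term
quote′ π (hole b)      = π b
quote′ π id′           = constant ⌜ idᶜ ⌝
quote′ π leaf′         = constant ⌜ leafᶜ ⌝
quote′ π fst′          = constant ⌜ fstᶜ ⌝
quote′ π snd′          = constant ⌜ sndᶜ ⌝
quote′ π (pair f g)    = pair (constant (num 4)) (pair (quote′ π f) (quote′ π g))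
quote′ π (f ⊙ g)       = pair (constant (num 5)) (pair (quote′ π f) (quote′ π g))
quote′ π (rec z s f g) =
  pair (constant (num 5))
    (pair (pair (constant (num 6)) (pair (quote′ π z) (quote′ π s)))
          (pair (constant (num 4)) (pair (quote′ π f) (quote′ π g))))

module _ {σ : Bool → Tree → Tree} {π : Bool → Term} {ρ : Bool → Code} {x : Tree}
         (π-quotes : ∀ b → eval σ (π b) x ≡ ⌜ ρ b ⌝) where

  eval-quote : ∀ t → eval σ (quote′ π t) x ≡ ⌜ inst ρ t ⌝
  eval-quote (hole b)      = π-quotes b
  eval-quote id′           = refl
  eval-quote leaf′         = refl
  eval-quote fst′          = refl
  eval-quote snd′          = refl
  eval-quote (pair f g)    = cong (node (num 4)) (cong₂ node (eval-quote f) (eval-quote g))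
  eval-quote (f ⊙ g)       = cong (node (num 5)) (cong₂ node (eval-quote f) (eval-quote g))
  eval-quote (rec z s f g) = cong (node (num 5)) (cong₂ node
    (cong (node (num 6)) (cong₂ node (eval-quote z) (eval-quote s)))
    (cong (node (num 4)) (cong₂ node (eval-quote f) (eval-quote g))))

<suc-elim : ∀ {P : ℕ → Set} {n} → (∀ i → i < n → P i) → P n → ∀ i → i < suc n → P i
<suc-elim below top i i<1+n = [ below i , (λ { refl → top }) ]′ (m≤n⇒m<n∨m≡n (≤-pred i<1+n))

IsNode : Pred Tree 0ℓ
IsNode t = ∃₂ λ l r → t ≡ node l r

-- Truth is represented by leaf and falsity by any other tree.

one′ : Term
one′ = pair leaf′ leaf′

-- In the step of a recursion: the parameter, the right subtree, the value on it.
param′ sub′ val′ : Term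
param′ = fst′
sub′   = snd′ ⊙ fst′ ⊙ snd′
val′   = snd′ ⊙ snd′ ⊙ snd′

if′ : (c t e : Term) → Term
if′ c t e = rec t (e ⊙ fst′) id′ c

-- The predecessor of a numeral is its right subtree, so `val′` is the value one iteration earlier.
iter′ : (g a b : Term) → Term
iter′ g a b = rec id′ (g ⊙ val′) a b

not′ : Term → Term
not′ c = if′ c one′ leaf′

-- Bounded quantification over the number that b computes; in the body the bound
-- variable is the right component of the input.
all′ any′ : (b c : Term) → Term
all′ b c = rec leaf′ (if′ val′ (c ⊙ pair param′ sub′) one′) id′ b
any′ b c = rec one′ (if′ val′ leaf′ (c ⊙ pair param′ sub′)) id′ b

module _ (σ : Bool → Tree → Tree) where

  Holds : Term → Tree → Set
  Holds c x = eval σ c x ≡ leaf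

  holds-not : ∀ c x → Holds (not′ c) x ⇔ IsNode (eval σ c x)
  holds-not c x with eval σ c x
  ... | leaf     = mk⇔ (λ ()) (λ ())
  ... | node l r = mk⇔ (λ _ → l , r , refl) (λ _ → refl)

  holds-all : ∀ b c x n → eval σ b x ≡ num n →
              Holds (all′ b c) x ⇔ (∀ i → i < n → Holds c (node x (num i)))
  holds-all b c x n eq rewrite eq = go n
    where
    P : ℕ → Tree
    P n = foldTree (eval σ leaf′) (eval σ (if′ val′ (c ⊙ pair param′ sub′) one′)) x (num n)
    go : ∀ n → P n ≡ leaf ⇔ (∀ i → i < n → Holds c (node x (num i)))
    go zero    = mk⇔ (λ _ _ ()) (λ _ → refl)
    go (suc n) with P n | go n
    ... | leaf | iff = mk⇔
      (λ h → <suc-elim (⇒ iff refl) h)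
      (λ h → h n ≤-refl)
    ... | node _ _ | iff = mk⇔ (λ ())
      (λ h → contradiction (⇐ iff λ i i<n → h i (m<n⇒m<1+n i<n)) λ ())

  holds-any : ∀ b c x n → eval σ b x ≡ num n →
              Holds (any′ b c) x ⇔ (∃ λ i → i < n × Holds c (node x (num i)))
  holds-any b c x n eq rewrite eq = go n
    where
    P : ℕ → Tree
    P n = foldTree (eval σ one′) (eval σ (if′ val′ leaf′ (c ⊙ pair param′ sub′))) x (num n)
    go : ∀ n → P n ≡ leaf ⇔ (∃ λ i → i < n × Holds c (node x (num i)))
    go zero    = mk⇔ (λ ()) (λ ())
    go (suc n) with P n | go n
    ... | leaf | iff = mk⇔
      (λ _ → let i , i<n , h = ⇒ iff refl in i , m<n⇒m<1+n i<n , h) (λ _ → refl)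
    ... | node _ _ | iff = mk⇔ (λ h → n , ≤-refl , h)
      (λ (i , i<1+n , h) → <suc-elim {λ i → Holds c (node x (num i)) → Holds c (node x (num n))}
        (λ i i<n h → contradiction (⇐ iff (i , i<n , h)) λ ()) id i i<1+n h)

  eval-iter : ∀ {A : Set} (code : A → Tree) (h : A → A) g →
              (∀ a → eval σ g (code a) ≡ code (h a)) →
              ∀ f b {x} a n → eval σ f x ≡ code a → eval σ b x ≡ num n →
              eval σ (iter′ g f b) x ≡ code (fold a h n)
  eval-iter code h g g≡h f b a n f≡a b≡n rewrite f≡a | b≡n = go n
    where
    go : ∀ n → foldTree (eval σ id′) (eval σ (g ⊙ val′)) (code a) (num n) ≡ code (fold a h n)
    go zero    = refl
    go (suc n) = trans (cong (eval σ g) (go n)) (g≡h _)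

-- Decoding of numbers

bit : Bool → ℕ
bit false = 0
bit true  = 1

parity : ℕ → ℕ
parity = bit ∘ proj₁ ∘ halve

advance : ℕ × ℕ → ℕ × ℕ
advance (zero  , j) = suc j , zero
advance (suc i , j) = i , suc j

unpair : ℕ → ℕ × ℕ
unpair = fold (0 , 0) advance

-- The walk of `advance` enters each antidiagonal at (s , 0), runs down to (0 , s) and goes on to (s
-- + 1 , 0).
unpair-onto : ∀ i j → ∃ λ n → unpair n ≡ (i , j)
unpair-onto i j = descend i j (axis (j + i))
  where
  descend : ∀ i j → (∃ λ n → unpair n ≡ (j + i , 0)) → ∃ λ n → unpair n ≡ (i , j)
  descend i zero    h = h
  descend i (suc j) h =
    let n , eq = descend (suc i) j (subst (λ k → ∃ λ n → unpair n ≡ (k , 0)) (sym (+-suc j i)) h)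
    in suc n , cong advance eq
  axis : ∀ s → ∃ λ n → unpair n ≡ (s , 0)
  axis zero    = 0 , refl
  axis (suc s) =
    let n , eq = descend 0 s (subst (λ k → ∃ λ n → unpair n ≡ (k , 0))
                                    (sym (+-identityʳ s)) (axis s))
    in suc n , cong advance eq

-- Halving `x` times; the parity of the result is binary digit number `x` of `m`.
shift : ℕ → ℕ → ℕ
shift x m = fold m index x

data Unary : Set where
  parityᵘ indexᵘ fstᵘ sndᵘ : Unary

⟦_⟧ᵘ : Unary → ℕ → ℕ
⟦ parityᵘ ⟧ᵘ = parity
⟦ indexᵘ  ⟧ᵘ = index
⟦ fstᵘ    ⟧ᵘ = proj₁ ∘ unpair
⟦ sndᵘ    ⟧ᵘ = proj₂ ∘ unpair

next′ halve′ advance′ unpair′ : Term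
next′    = if′ fst′ (pair one′ snd′) (pair leaf′ (pair leaf′ snd′))
halve′   = iter′ next′ (pair leaf′ leaf′) id′
advance′ = if′ fst′ (pair (pair leaf′ snd′) leaf′) (pair (snd′ ⊙ fst′) (pair leaf′ snd′))
unpair′  = iter′ advance′ (pair leaf′ leaf′) id′

unary′ : Unary → Term
unary′ parityᵘ = fst′ ⊙ halve′
unary′ indexᵘ  = snd′ ⊙ halve′
unary′ fstᵘ    = fst′ ⊙ unpair′
unary′ sndᵘ    = snd′ ⊙ unpair′

module _ (σ : Bool → Tree → Tree) where

  eval-halve : ∀ n → eval σ halve′ (num n) ≡ pairTree (halve n)
  eval-halve n = trans
    (eval-iter σ pairTree next next′ (λ { (false , _) → refl ; (true , _) → refl })
       (pair leaf′ leaf′) id′ (false , 0) n refl refl)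
    (cong pairTree (halve-fold n))
    where
    halve-fold : ∀ n → fold (false , 0) next n ≡ halve n
    halve-fold zero    = refl
    halve-fold (suc n) = cong next (halve-fold n)

  numPair : ℕ × ℕ → Tree
  numPair (i , j) = node (num i) (num j)

  eval-unpair : ∀ n → eval σ unpair′ (num n) ≡ numPair (unpair n)
  eval-unpair n = eval-iter σ numPair advance advance′
                    (λ { (zero , _) → refl ; (suc _ , _) → refl })
                    (pair leaf′ leaf′) id′ (0 , 0) n refl refl

  flag≡bit : ∀ b → flag b ≡ num (bit b)
  flag≡bit false = refl
  flag≡bit true  = refl

  eval-unary : ∀ u n → eval σ (unary′ u) (num n) ≡ num (⟦ u ⟧ᵘ n)
  eval-unary parityᵘ n = trans (cong left (eval-halve n)) (flag≡bit _)
  eval-unary indexᵘ  n = cong right (eval-halve n)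
  eval-unary fstᵘ    n = cong left (eval-unpair n)
  eval-unary sndᵘ    n = cong right (eval-unpair n)

-- Formulas with bounded quantifiers

data Expr (n : ℕ) : Set where
  var   : Fin n → Expr n
  app   : Unary → Expr n → Expr n
  shiftᵉ : (x m : Expr n) → Expr n

infixr 6 _∧ᶠ_
infixr 5 _⇒ᶠ_
infix  7 _<ᶠ_

data Formula (n : ℕ) : Set where
  zeroᶠ     : Expr n → Formula n
  _<ᶠ_      : (a b : Expr n) → Formula n
  belowᶠ    : (j x y : Expr n) → Formula n
  hitᶠ      : (j x : Expr n) → Formula n
  _∧ᶠ_ _⇒ᶠ_ : (φ ψ : Formula n) → Formula n
  ¬ᶠ_       : Formula n → Formula n
  ∀< ∃<     : Expr n → Formula (suc n) → Formula n

⟦_⟧ᵉ : ∀ {n} → Expr n → Vec ℕ n → ℕ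
⟦ var i ⟧ᵉ      ρ = lookup ρ i
⟦ app u a ⟧ᵉ    ρ = ⟦ u ⟧ᵘ (⟦ a ⟧ᵉ ρ)
⟦ shiftᵉ x m ⟧ᵉ ρ = shift (⟦ x ⟧ᵉ ρ) (⟦ m ⟧ᵉ ρ)

module Semantics (σ : Bool → Tree → Tree) where

  -- The quantifier over smaller bounds makes this monotone in `j` by definition.
  Within : Bool → ℕ → Tree → Set
  Within b j t = ∃ λ i → i < j × IsNode (σ b (node (num i) t))

  Below : ℕ → ℕ → ℕ → Set
  Below j x y = Within false j (node (num x) (num y))

  Hit : ℕ → ℕ → Set
  Hit j x = Within true j (num x)

  ⟦_⟧ : ∀ {n} → Formula n → Vec ℕ n → Set
  ⟦ zeroᶠ a ⟧      ρ = ⟦ a ⟧ᵉ ρ ≡ 0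
  ⟦ a <ᶠ b ⟧       ρ = ⟦ a ⟧ᵉ ρ < ⟦ b ⟧ᵉ ρ
  ⟦ belowᶠ j x y ⟧ ρ = Below (⟦ j ⟧ᵉ ρ) (⟦ x ⟧ᵉ ρ) (⟦ y ⟧ᵉ ρ)
  ⟦ hitᶠ j x ⟧     ρ = Hit (⟦ j ⟧ᵉ ρ) (⟦ x ⟧ᵉ ρ)
  ⟦ φ ∧ᶠ ψ ⟧       ρ = ⟦ φ ⟧ ρ × ⟦ ψ ⟧ ρ
  ⟦ φ ⇒ᶠ ψ ⟧       ρ = ⟦ φ ⟧ ρ → ⟦ ψ ⟧ ρ
  ⟦ ¬ᶠ φ ⟧         ρ = ¬ ⟦ φ ⟧ ρ
  ⟦ ∀< b φ ⟧       ρ = ∀ i → i < ⟦ b ⟧ᵉ ρ → ⟦ φ ⟧ (i ∷ ρ)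
  ⟦ ∃< b φ ⟧       ρ = ∃ λ i → i < ⟦ b ⟧ᵉ ρ × ⟦ φ ⟧ (i ∷ ρ)

-- The innermost variable stands on the right, where `all′` and `any′` put it.
environment : ∀ {n} → Vec ℕ n → Tree
environment []      = leaf
environment (x ∷ ρ) = node (environment ρ) (num x)

var′ : ∀ {n} → Fin n → Term
var′ zero    = snd′
var′ (suc i) = var′ i ⊙ fst′

compileᵉ : ∀ {n} → Expr n → Term
compileᵉ (var i)      = var′ i
compileᵉ (app u a)    = unary′ u ⊙ compileᵉ a
compileᵉ (shiftᵉ x m) = iter′ (unary′ indexᵘ) (compileᵉ m) (compileᵉ x)

-- Success of a bounded program is a node, whereas truth is leaf; hence the negation.
within′ : (b : Bool) (j t : Term) → Term
within′ b j t = any′ j (not′ (hole b ⊙ pair snd′ (t ⊙ fst′)))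

compile : ∀ {n} → Formula n → Term
compile (zeroᶠ a)      = compileᵉ a
-- Truncated subtraction: taking `b` predecessors of the successor of `a` ends in leaf exactly if
-- `a` is less than `b`.
compile (a <ᶠ b)       = iter′ snd′ (pair leaf′ (compileᵉ a)) (compileᵉ b)
compile (belowᶠ j x y) = within′ false (compileᵉ j) (pair (compileᵉ x) (compileᵉ y))
compile (hitᶠ j x)     = within′ true (compileᵉ j) (compileᵉ x)
compile (φ ∧ᶠ ψ)       = if′ (compile φ) (compile ψ) one′
compile (φ ⇒ᶠ ψ)       = if′ (compile φ) (compile ψ) leaf′
compile (¬ᶠ φ)         = not′ (compile φ)
compile (∀< b φ)       = all′ (compileᵉ b) (compile φ)
compile (∃< b φ)       = any′ (compileᵉ b) (compile φ)

module _ (σ : Bool → Tree → Tree) where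
  open Semantics σ

  eval-compileᵉ : ∀ {n} (a : Expr n) ρ → eval σ (compileᵉ a) (environment ρ) ≡ num (⟦ a ⟧ᵉ ρ)
  eval-compileᵉ (var zero)     (_ ∷ ρ) = refl
  eval-compileᵉ (var (suc i))  (_ ∷ ρ) = eval-compileᵉ (var i) ρ
  eval-compileᵉ (app u a)      ρ =
    trans (cong (eval σ (unary′ u)) (eval-compileᵉ a ρ)) (eval-unary σ u _)
  eval-compileᵉ (shiftᵉ x m)   ρ = eval-iter σ num index (unary′ indexᵘ) (eval-unary σ indexᵘ)
    (compileᵉ m) (compileᵉ x) (⟦ m ⟧ᵉ ρ) (⟦ x ⟧ᵉ ρ) (eval-compileᵉ m ρ) (eval-compileᵉ x ρ)

  holds-within : ∀ b j t {x n y} → eval σ j x ≡ num n → eval σ t x ≡ y →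
                 Holds σ (within′ b j t) x ⇔ Within b n y
  holds-within b j t {x} {n} j≡n refl = mk⇔
    (λ h → map₂ (map₂ (⇒ (holds-not σ body _))) (⇒ iff h))
    (λ w → ⇐ iff (map₂ (map₂ (⇐ (holds-not σ body _))) w))
    where
    body : Term
    body = hole b ⊙ pair snd′ (t ⊙ fst′)
    iff : Holds σ (within′ b j t) x ⇔ (∃ λ i → i < n × Holds σ (not′ body) (node x (num i)))
    iff = holds-any σ j (not′ body) x n j≡n

  num-zero : ∀ n → num n ≡ leaf ⇔ n ≡ 0
  num-zero zero    = mk⇔ (λ _ → refl) (λ _ → refl)
  num-zero (suc n) = mk⇔ (λ ()) (λ ())

  fold-pred-zero : ∀ a b → fold (suc a) pred b ≡ 0 ⇔ a < b
  fold-pred-zero a b = mk⇔ (λ h → m∸n≡0⇒m≤n (trans (sym (go b)) h))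
                           (λ a<b → trans (go b) (m≤n⇒m∸n≡0 a<b))
    where
    go : ∀ b → fold (suc a) pred b ≡ suc a ∸ b
    go zero    = refl
    go (suc b) = trans (cong pred (go b)) (pred[m∸n]≡m∸[1+n] (suc a) b)

  compile-correct : ∀ {n} (φ : Formula n) ρ → Holds σ (compile φ) (environment ρ) ⇔ ⟦ φ ⟧ ρ
  compile-correct (zeroᶠ a) ρ rewrite eval-compileᵉ a ρ = num-zero _
  compile-correct (a <ᶠ b) ρ =
    mk⇔ (λ h → ⇒ (fold-pred-zero m n) (⇒ (num-zero _) (trans (sym difference) h)))
        (λ h → trans difference (⇐ (num-zero _) (⇐ (fold-pred-zero m n) h)))
    where
    m = ⟦ a ⟧ᵉ ρ
    n = ⟦ b ⟧ᵉ ρ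
    difference : eval σ (compile (a <ᶠ b)) (environment ρ) ≡ num (fold (suc m) pred n)
    difference = eval-iter σ num pred snd′ (λ { zero → refl ; (suc _) → refl })
      (pair leaf′ (compileᵉ a)) (compileᵉ b) (suc m) n
      (cong (node leaf) (eval-compileᵉ a ρ)) (eval-compileᵉ b ρ)
  compile-correct (belowᶠ j x y) ρ =
    holds-within false (compileᵉ j) (pair (compileᵉ x) (compileᵉ y)) (eval-compileᵉ j ρ)
      (cong₂ node (eval-compileᵉ x ρ) (eval-compileᵉ y ρ))
  compile-correct (hitᶠ j x) ρ =
    holds-within true (compileᵉ j) (compileᵉ x) (eval-compileᵉ j ρ) (eval-compileᵉ x ρ)
  compile-correct (φ ∧ᶠ ψ) ρ with eval σ (compile φ) (environment ρ) | compile-correct φ ρ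
  ... | leaf | iff = mk⇔ (λ h → ⇒ iff refl , ⇒ (compile-correct ψ ρ) h)
                         (⇐ (compile-correct ψ ρ) ∘ proj₂)
  ... | node _ _ | iff = mk⇔ (λ ()) (λ (h , _) → contradiction (⇐ iff h) λ ())
  compile-correct (φ ⇒ᶠ ψ) ρ with eval σ (compile φ) (environment ρ) | compile-correct φ ρ
  ... | leaf | iff = mk⇔ (λ h _ → ⇒ (compile-correct ψ ρ) h)
                         (λ h → ⇐ (compile-correct ψ ρ) (h (⇒ iff refl)))
  ... | node _ _ | iff = mk⇔ (λ _ h → contradiction (⇐ iff h) λ ()) (λ _ → refl)
  compile-correct (¬ᶠ φ) ρ with eval σ (compile φ) (environment ρ) | compile-correct φ ρ
  ... | leaf | iff = mk⇔ (λ ()) (λ h → contradiction (⇒ iff refl) h)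
  ... | node _ _ | iff = mk⇔ (λ _ h → contradiction (⇐ iff h) λ ()) (λ _ → refl)
  compile-correct (∀< b φ) ρ = mk⇔
    (λ h i i<n → ⇒ (compile-correct φ (i ∷ ρ)) (⇒ iff h i i<n))
    (λ h → ⇐ iff λ i i<n → ⇐ (compile-correct φ (i ∷ ρ)) (h i i<n))
    where iff = holds-all σ (compileᵉ b) (compile φ) (environment ρ) _ (eval-compileᵉ b ρ)
  compile-correct (∃< b φ) ρ = mk⇔
    (λ h → map₂ (map₂ (⇒ (compile-correct φ _))) (⇒ iff h))
    (λ h → ⇐ iff (map₂ (map₂ (⇐ (compile-correct φ _))) h))
    where iff = holds-any σ (compileᵉ b) (compile φ) (environment ρ) _ (eval-compileᵉ b ρ)

-- Evaluation with a bound k on all minimisations: on input (k , x) the result is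
-- leaf if the bound does not suffice, and otherwise a node whose right subtree is
-- the output.

fail′ : Term
fail′ = leaf′

succeed′ : Term → Term
succeed′ t = pair leaf′ t

const′ : Term → Term
const′ t = succeed′ (t ⊙ snd′)

pairᵇ compᵇ recStepᵇ recᵇ : Term
pairᵇ    = if′ fst′ fail′ (if′ snd′ fail′ (succeed′ (pair (snd′ ⊙ fst′) (snd′ ⊙ snd′))))
             ⊙ pair (hole false) (hole true)
compᵇ    = if′ snd′ fail′ (hole false ⊙ pair fst′ (snd′ ⊙ snd′)) ⊙ pair fst′ (hole true)
recStepᵇ = if′ (fst′ ⊙ snd′ ⊙ snd′) fail′ (if′ val′ fail′
             (hole true ⊙ pair (fst′ ⊙ fst′)
               (pair (snd′ ⊙ fst′) (pair (fst′ ⊙ snd′)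
                 (pair (snd′ ⊙ fst′ ⊙ snd′ ⊙ snd′) (snd′ ⊙ val′))))))
-- `recᶜ` diverges on the input leaf, so the bounded version fails there.
recᵇ     = if′ snd′ fail′ (rec (hole false) recStepᵇ (pair fst′ (fst′ ⊙ snd′)) (snd′ ⊙ snd′))

-- The state of the search is leaf as long as all outputs are nodes, then (leaf , i)
-- if the output at i is leaf, or a pair with non-leaf left component if the bound
-- does not suffice at some point.
searchStepᵇ searchᵇ μᵇ : Term
searchStepᵇ = if′ val′
  (if′ fst′ (pair one′ leaf′) (if′ (snd′ ⊙ fst′) (pair leaf′ snd′) leaf′) ⊙
    pair (hole false ⊙ pair (fst′ ⊙ fst′) (pair (snd′ ⊙ fst′) sub′)) sub′)
  val′
searchᵇ     = rec leaf′ searchStepᵇ id′ fst′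
μᵇ          = if′ id′ fail′ (if′ fst′ id′ fail′) ⊙ searchᵇ

bounded : Code → Code
bounded idᶜ        = inst (pick idᶜ idᶜ) (const′ id′)
bounded leafᶜ      = inst (pick idᶜ idᶜ) (const′ leaf′)
bounded fstᶜ       = inst (pick idᶜ idᶜ) (const′ fst′)
bounded sndᶜ       = inst (pick idᶜ idᶜ) (const′ snd′)
bounded ⟨ f , g ⟩  = inst (pick (bounded f) (bounded g)) pairᵇ
bounded (f ∘ᶜ g)   = inst (pick (bounded f) (bounded g)) compᵇ
bounded (recᶜ z s) = inst (pick (bounded z) (bounded s)) recᵇ
bounded (μ f)      = inst (pick (bounded f) idᶜ) μᵇ

⟦_⟧ᵇ : Code → Tree → Tree
⟦ idᶜ ⟧ᵇ      = eval (pick id id) (const′ id′)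
⟦ leafᶜ ⟧ᵇ    = eval (pick id id) (const′ leaf′)
⟦ fstᶜ ⟧ᵇ     = eval (pick id id) (const′ fst′)
⟦ sndᶜ ⟧ᵇ     = eval (pick id id) (const′ snd′)
⟦ ⟨ f , g ⟩ ⟧ᵇ  = eval (pick ⟦ f ⟧ᵇ ⟦ g ⟧ᵇ) pairᵇ
⟦ f ∘ᶜ g ⟧ᵇ   = eval (pick ⟦ f ⟧ᵇ ⟦ g ⟧ᵇ) compᵇ
⟦ recᶜ z s ⟧ᵇ = eval (pick ⟦ z ⟧ᵇ ⟦ s ⟧ᵇ) recᵇ
⟦ μ f ⟧ᵇ      = eval (pick ⟦ f ⟧ᵇ id) μᵇ

inst-pick-⇓ : ∀ {c d} F G → (∀ x → c · x ⇓ F x) → (∀ x → d · x ⇓ G x) →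
              ∀ t x → inst (pick c d) t · x ⇓ eval (pick F G) t x
inst-pick-⇓ {c} {d} F G c⇓ d⇓ =
  inst-⇓ {pick c d} {pick F G} λ { false → c⇓ ; true → d⇓ }

bounded-⇓ : ∀ c x → bounded c · x ⇓ ⟦ c ⟧ᵇ x
bounded-⇓ idᶜ        = inst-pick-⇓ id id (λ _ → ⇓id) (λ _ → ⇓id) (const′ id′)
bounded-⇓ leafᶜ      = inst-pick-⇓ id id (λ _ → ⇓id) (λ _ → ⇓id) (const′ leaf′)
bounded-⇓ fstᶜ       = inst-pick-⇓ id id (λ _ → ⇓id) (λ _ → ⇓id) (const′ fst′)
bounded-⇓ sndᶜ       = inst-pick-⇓ id id (λ _ → ⇓id) (λ _ → ⇓id) (const′ snd′)
bounded-⇓ ⟨ f , g ⟩  = inst-pick-⇓ ⟦ f ⟧ᵇ ⟦ g ⟧ᵇ (bounded-⇓ f) (bounded-⇓ g) pairᵇ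
bounded-⇓ (f ∘ᶜ g)   = inst-pick-⇓ ⟦ f ⟧ᵇ ⟦ g ⟧ᵇ (bounded-⇓ f) (bounded-⇓ g) compᵇ
bounded-⇓ (recᶜ z s) = inst-pick-⇓ ⟦ z ⟧ᵇ ⟦ s ⟧ᵇ (bounded-⇓ z) (bounded-⇓ s) recᵇ
bounded-⇓ (μ f)      = inst-pick-⇓ ⟦ f ⟧ᵇ id (bounded-⇓ f) (λ _ → ⇓id) μᵇ

-- Soundness of bounded evaluation

module Search (f : Code) (K x : Tree) where

  trial : ℕ → Tree
  trial i = ⟦ f ⟧ᵇ (node K (node x (num i)))

  state : ℕ → Tree
  state n = foldTree (const leaf) (eval (pick ⟦ f ⟧ᵇ id) searchStepᵇ) (node K x) (num n)

  Passed : ℕ → Set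
  Passed n = ∀ i → i < n → ∃₂ λ w l → ∃ λ r → trial i ≡ node w (node l r)

  Found : Tree → Set
  Found y = ∃₂ λ n w → y ≡ num n × trial n ≡ node w leaf × Passed n

  passed-suc : ∀ {n w l r} → Passed n → trial n ≡ node w (node l r) → Passed (suc n)
  passed-suc passed eq = <suc-elim passed (_ , _ , _ , eq)

  classify : ℕ → Tree → Tree
  classify n leaf                = node (node leaf leaf) leaf
  classify n (node _ leaf)       = node leaf (num n)
  classify n (node _ (node _ _)) = leaf

  state-suc : ∀ n {t} → state n ≡ leaf → trial n ≡ t → state (suc n) ≡ classify n t
  state-suc n {leaf}              eq eq′ rewrite eq | eq′ = refl
  state-suc n {node _ leaf}       eq eq′ rewrite eq | eq′ = refl
  state-suc n {node _ (node _ _)} eq eq′ rewrite eq | eq′ = refl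

  state-stable : ∀ n {l r} → state n ≡ node l r → state (suc n) ≡ node l r
  state-stable n eq rewrite eq = refl

  -- The invariant of the search; nothing is claimed about a state of failure.
  Sound : ℕ → Tree → Set
  Sound n t = (t ≡ leaf → Passed n) × (∀ {y} → t ≡ node leaf y → Found y)

  sound-suc : ∀ n s t → state n ≡ s → trial n ≡ t → Sound n s → Sound (suc n) (state (suc n))
  sound-suc n (node _ _) t eqs eqt (_ , found) =
    subst (Sound (suc n)) (sym (state-stable n eqs)) ((λ ()) , found)
  sound-suc n leaf t eqs eqt (passed , _) =
    subst (Sound (suc n)) (sym (state-suc n eqs eqt)) (classify-sound t eqt)
    where
    classify-sound : ∀ t → trial n ≡ t → Sound (suc n) (classify n t)
    classify-sound leaf                eqt = (λ ()) , λ ()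
    classify-sound (node w leaf)       eqt = (λ ()) , λ { refl → n , w , refl , eqt , passed refl }
    classify-sound (node w (node l r)) eqt = (λ _ → passed-suc (passed refl) eqt) , λ ()

  state-sound : ∀ n → Sound n (state n)
  state-sound zero    = (λ _ _ ()) , λ ()
  state-sound (suc n) = sound-suc n (state n) (trial n) refl refl (state-sound n)

  state-passed : ∀ n → Passed n → state n ≡ leaf
  state-passed zero    passed = refl
  state-passed (suc n) passed with _ , _ , _ , eq ← passed n ≤-refl =
    state-suc n (state-passed n (λ i → passed i ∘ m<n⇒m<1+n)) eq

  state-found : ∀ {n w} → trial n ≡ node w leaf → Passed n →
                ∀ m → n < m → state m ≡ node leaf (num n)
  state-found {n} eq passed (suc m) n<1+m with m≤n⇒m<n∨m≡n (≤-pred n<1+m)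
  ... | inj₁ n<m  = state-stable m (state-found eq passed m n<m)
  ... | inj₂ refl = state-suc n (state-passed n passed) eq

-- Failure of any subevaluation makes the result leaf, so a node certifies that all of them
-- succeeded, and induction on the code applies.
bounded-sound : ∀ c k {x w y} → ⟦ c ⟧ᵇ (node (num k) x) ≡ node w y → c · x ⇓ y
bounded-sound idᶜ k refl = ⇓id
bounded-sound leafᶜ k refl = ⇓leaf
bounded-sound fstᶜ k {leaf} refl = ⇓fst₀
bounded-sound fstᶜ k {node _ _} refl = ⇓fst
bounded-sound sndᶜ k {leaf} refl = ⇓snd₀
bounded-sound sndᶜ k {node _ _} refl = ⇓snd
bounded-sound ⟨ f , g ⟩ k {x} eq
  with ⟦ f ⟧ᵇ (node (num k) x) in eqf
... | node _ _ with ⟦ g ⟧ᵇ (node (num k) x) in eqg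
...   | node _ _ with refl ← eq =
  ⇓pair (bounded-sound f k eqf) (bounded-sound g k eqg)
bounded-sound (f ∘ᶜ g) k {x} eq with ⟦ g ⟧ᵇ (node (num k) x) in eqg
... | node _ _ = ⇓comp (bounded-sound g k eqg) (bounded-sound f k eq)
bounded-sound (recᶜ z s) k {node x t} = go t
  where
  value : Tree → Tree
  value = foldTree ⟦ z ⟧ᵇ (eval (pick ⟦ z ⟧ᵇ ⟦ s ⟧ᵇ) recStepᵇ) (node (num k) x)
  go : ∀ t {w y} → value t ≡ node w y → recᶜ z s · node x t ⇓ y
  go leaf eq = ⇓rec₀ (bounded-sound z k eq)
  go (node l r) eq with value l in eql
  ... | node _ _ with value r in eqr
  ...   | node _ _ = ⇓rec (go l eql) (go r eqr) (bounded-sound s k eq)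
bounded-sound (μ f) k {x} eq with state k | state-sound k
  where open Search f (num k) x
... | node leaf _ | _ , found with refl ← eq | n , _ , refl , n⇓ , passed ← found refl =
  ⇓μ n (bounded-sound f k n⇓) λ i<n →
    let _ , _ , _ , i⇓ = passed _ i<n in _ , _ , bounded-sound f k i⇓

-- Completeness of bounded evaluation for large bounds

Output : Code → ℕ → Tree → Tree → Set
Output c k x y = ∃ λ w → ⟦ c ⟧ᵇ (node (num k) x) ≡ node w y

-- Asking for all large bounds instead of one lets finitely many requirements be met at once, at the
-- maximum of their thresholds.
Eventually : (ℕ → Set) → Set
Eventually P = ∃ λ K → ∀ k → K ≤ k → P k

infixr 4 _∩ₑ_
_∩ₑ_ : ∀ {P Q} → Eventually P → Eventually Q → Eventually (λ k → P k × Q k)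
(K , p) ∩ₑ (L , q) = K ⊔ L , λ k h → p k (m⊔n≤o⇒m≤o K L h) , q k (m⊔n≤o⇒n≤o K L h)

mapₑ : ∀ {P Q : ℕ → Set} → (∀ {k} → P k → Q k) → Eventually P → Eventually Q
mapₑ f = map₂ λ p k h → f (p k h)

eventually-≥ : ∀ n → Eventually (n ≤_)
eventually-≥ n = n , λ _ → id

eventually-∀< : ∀ {P : ℕ → ℕ → Set} n → (∀ i → i < n → Eventually (P i)) →
                Eventually λ k → ∀ i → i < n → P i k
eventually-∀< zero    h = 0 , λ _ _ _ ()
eventually-∀< {P} (suc n) h = mapₑ
  (λ (p , q) → <suc-elim q p)
  (h n ≤-refl ∩ₑ eventually-∀< {P} n λ i → h i ∘ m<n⇒m<1+n)

bounded-complete : ∀ {c x y} → c · x ⇓ y → Eventually λ k → Output c k x y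
bounded-complete ⇓id = 0 , λ _ _ → _ , refl
bounded-complete ⇓leaf = 0 , λ _ _ → _ , refl
bounded-complete ⇓fst₀ = 0 , λ _ _ → _ , refl
bounded-complete ⇓fst = 0 , λ _ _ → _ , refl
bounded-complete ⇓snd₀ = 0 , λ _ _ → _ , refl
bounded-complete ⇓snd = 0 , λ _ _ → _ , refl
bounded-complete (⇓pair {f} {g} {x} {y} {z} p q) =
  mapₑ step (bounded-complete p ∩ₑ bounded-complete q)
  where
  step : ∀ {k} → Output f k x y × Output g k x z → Output ⟨ f , g ⟩ k x (node y z)
  step ((_ , eqf) , (_ , eqg)) rewrite eqf | eqg = _ , refl
bounded-complete (⇓comp {f} {g} {x} {y} {z} p q) =
  mapₑ step (bounded-complete p ∩ₑ bounded-complete q)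
  where
  step : ∀ {k} → Output g k x y × Output f k y z → Output (f ∘ᶜ g) k x z
  step ((_ , eqg) , eqf) rewrite eqg = eqf
bounded-complete (⇓rec₀ p) = bounded-complete p
bounded-complete (⇓rec {z} {s} {x} {l} {r} {u} {v} {y} p q h) =
  mapₑ step (bounded-complete p ∩ₑ bounded-complete q ∩ₑ bounded-complete h)
  where
  step : ∀ {k} → Output (recᶜ z s) k (node x l) u × Output (recᶜ z s) k (node x r) v ×
                 Output s k (node x (node (node l r) (node u v))) y →
         Output (recᶜ z s) k (node x (node l r)) y
  step ((_ , eql) , (_ , eqr) , eqs) rewrite eql | eqr = eqs
bounded-complete (⇓μ {f} {x} n p h) =
  -- The search tries only numbers smaller than the bound, so the bound has to exceed `n`.
  mapₑ step (eventually-≥ (suc n) ∩ₑ bounded-complete p ∩ₑ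
    eventually-∀< {λ i k → ∃₂ λ w l → ∃ λ r →
                     ⟦ f ⟧ᵇ (node (num k) (node x (num i))) ≡ node w (node l r)} n
      λ _ i<n → mapₑ (λ (w , eq) → w , _ , _ , eq) (bounded-complete (proj₂ (proj₂ (h i<n)))))
  where
  step : ∀ {k} → suc n ≤ k × Output f k (node x (num n)) leaf × Search.Passed f (num k) x n →
         Output (μ f) k x (num n)
  step {k} (n<k , (_ , eq) , passed)
    rewrite Search.state-found f (num k) x eq passed k n<k = _ , refl

-- Computability of the transformation `bounded` on codes

noHoles oneHole twoHoles : Bool → Term
noHoles  = const (constant ⌜ idᶜ ⌝)
oneHole  = pick (fst′ ⊙ val′) (constant ⌜ idᶜ ⌝)
twoHoles = pick (fst′ ⊙ snd′ ⊙ val′) (snd′ ⊙ snd′ ⊙ val′)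

dispatch′ : Term
dispatch′ =
  if′ (tag 0) (quote′ noHoles (const′ id′)) (
  if′ (tag 1) (quote′ noHoles (const′ leaf′)) (
  if′ (tag 2) (quote′ noHoles (const′ fst′)) (
  if′ (tag 3) (quote′ noHoles (const′ snd′)) (
  if′ (tag 4) (quote′ twoHoles pairᵇ) (
  if′ (tag 5) (quote′ twoHoles compᵇ) (
  if′ (tag 6) (quote′ twoHoles recᵇ)
              (quote′ oneHole μᵇ)))))))
  where
  -- True if the tag is at most `n`; since the tests come in ascending order, the first to succeed
  -- identifies the tag.
  tag : ℕ → Term
  tag zero    = fst′ ⊙ fst′ ⊙ snd′
  tag (suc n) = snd′ ⊙ tag n

-- The value at ⌜ c ⌝ has ⌜ bounded c ⌝ as its left component; the right component
-- contains the left components of the values at the two subtrees, which serve when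
-- the tree is the pair of the codes of two arguments.

boundedStep′ bounded′ : Term
boundedStep′ = pair dispatch′ (pair (fst′ ⊙ fst′ ⊙ snd′ ⊙ snd′) (fst′ ⊙ val′))
bounded′     = fst′ ⊙ rec leaf′ boundedStep′ leaf′ id′

module _ (σ : Bool → Tree → Tree) where

  value : Tree → Tree
  value = eval σ (rec leaf′ boundedStep′ leaf′ id′)

  stepInput : Tree → Tree → Tree
  stepInput l r = node leaf (node (node l r) (node (value l) (value r)))

  eval-bounded : ∀ c → eval σ bounded′ ⌜ c ⌝ ≡ ⌜ bounded c ⌝

  eval-binary : ∀ n f g t → eval σ (quote′ twoHoles t) (stepInput (num n) (node ⌜ f ⌝ ⌜ g ⌝)) ≡
                ⌜ inst (pick (bounded f) (bounded g)) t ⌝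
  eval-binary n f g = eval-quote {σ} {twoHoles} {pick (bounded f) (bounded g)}
    {stepInput (num n) (node ⌜ f ⌝ ⌜ g ⌝)}
    λ { false → eval-bounded f ; true → eval-bounded g }

  eval-bounded idᶜ        = refl
  eval-bounded leafᶜ      = refl
  eval-bounded fstᶜ       = refl
  eval-bounded sndᶜ       = refl
  eval-bounded ⟨ f , g ⟩  = eval-binary 4 f g pairᵇ
  eval-bounded (f ∘ᶜ g)   = eval-binary 5 f g compᵇ
  eval-bounded (recᶜ z s) = eval-binary 6 z s recᵇ
  eval-bounded (μ f)      = eval-quote {σ} {oneHole} {pick (bounded f) idᶜ}
    {stepInput (num 7) ⌜ f ⌝}
    (λ { false → eval-bounded f ; true → refl }) μᵇ

-- A formula φ(j , b , a) defines the c.e. relation ∃ j φ(j , b , a) between a and b.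

test′ : Formula 3 → Term
-- Minimisation supplies ((a , b) , j), while the environment of j, b, a is (((leaf , a) , b) , j).
test′ φ = compile φ ⊙ pair (pair (pair leaf′ (fst′ ⊙ fst′)) (snd′ ⊙ fst′)) snd′

semi : Formula 3 → Code → Code → Code
semi φ e u = μ (inst (pick (bounded e) (bounded u)) (test′ φ))

-- Only the fillers of the two holes depend on the indices; their codes come from `bounded′`, and
-- quotation supplies the rest.
semi-computable : ∀ φ → Computable₂ (semi φ)
semi-computable φ = inst (const idᶜ) program , λ d e →
  subst (inst (const idᶜ) program · node ⌜ d ⌝ ⌜ e ⌝ ⇓_) (correct d e)
    (inst-⇓ {σ = σ} (λ _ _ → ⇓id) program _)
  where
  σ : Bool → Tree → Tree
  σ _ = id
  holes : Bool → Term
  holes = pick (bounded′ ⊙ fst′) (bounded′ ⊙ snd′)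
  program : Term
  program = pair (constant (num 7)) (quote′ holes (test′ φ))
  correct : ∀ d e → eval σ program (node ⌜ d ⌝ ⌜ e ⌝) ≡ ⌜ semi φ d e ⌝
  correct d e = cong (node (num 7))
    (eval-quote {σ} {holes} {pick (bounded d) (bounded e)} {node ⌜ d ⌝ ⌜ e ⌝}
      (λ { false → eval-bounded σ d ; true → eval-bounded σ e }) (test′ φ))

least-leaf : ∀ (g : ℕ → Tree) j → g j ≡ leaf → ∃ λ n → g n ≡ leaf × (∀ {i} → i < n → IsNode (g i))
least-leaf g zero    eq = 0 , eq , λ ()
least-leaf g (suc j) eq with g 0 in eq₀
... | leaf = 0 , eq₀ , λ ()
... | node l r with n , eqn , h ← least-leaf (g ∘ suc) j eq =
  suc n , eqn , λ { {zero} _ → l , r , eq₀ ; {suc i} (s≤s i<n) → h i<n }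

module _ (e u : Code) where

  semantics : Bool → Tree → Tree
  semantics = pick ⟦ e ⟧ᵇ ⟦ u ⟧ᵇ

  open Semantics semantics

  semi-correct : ∀ φ a b → W₂ (semi φ e u) a b ⇔ (∃ λ j → ⟦ φ ⟧ (j ∷ b ∷ a ∷ []))
  semi-correct φ a b = mk⇔
    (λ { (_ , ⇓μ j p _) → j , ⇒ (compile-correct semantics φ _) (det (program-⇓ j) p) })
    (λ (j , h) →
      let n , eq , nodes = least-leaf output j (⇐ (compile-correct semantics φ (j ∷ b ∷ a ∷ [])) h)
      in _ , ⇓μ n (subst (program · input n ⇓_) eq (program-⇓ n))
                  (λ {i} i<n → let l , r , eq′ = nodes i<n
                               in l , r , subst (program · input i ⇓_) eq′ (program-⇓ i)))
    where
    program : Code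
    program = inst (pick (bounded e) (bounded u)) (test′ φ)
    input output : ℕ → Tree
    input j  = node (node (num a) (num b)) (num j)
    output j = eval semantics (test′ φ) (input j)
    program-⇓ : ∀ j → program · input j ⇓ output j
    program-⇓ j = inst-pick-⇓ ⟦ e ⟧ᵇ ⟦ u ⟧ᵇ (bounded-⇓ e) (bounded-⇓ u) (test′ φ) (input j)

  Within-mono : ∀ {b j k t} → j ≤ k → Within b j t → Within b k t
  Within-mono j≤k (i , i<j , h) = i , ≤-trans i<j j≤k , h

  Within-sound : ∀ b {j t} → Within b j t → pick e u b ↓ t
  Within-sound false (i , _ , _ , _ , eq) = _ , bounded-sound e i eq
  Within-sound true  (i , _ , _ , _ , eq) = _ , bounded-sound u i eq

  converges-within : ∀ b {t y} →
                     (Eventually λ k → ∃ λ w → semantics b (node (num k) t) ≡ node w y) →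
                     Eventually λ j → Within b j t
  converges-within b (K , h) = suc K , λ k K<k → K , K<k , _ , _ , proj₂ (h K ≤-refl)

  Within-complete : ∀ b {t} → pick e u b ↓ t → Eventually λ j → Within b j t
  Within-complete false (_ , d) = converges-within false (bounded-complete d)
  Within-complete true  (_ , d) = converges-within true (bounded-complete d)

-- A number p codes a tag, a finite set and a stage; only the elements of the set
-- that are smaller than the stage count.

stage tag : ℕ → ℕ
stage p = proj₂ (unpair p)
tag p   = parity (proj₁ (unpair p))

Bit : ℕ → ℕ → Set
Bit x p = ¬ parity (shift x (index (proj₁ (unpair p)))) ≡ 0

record Elem (p x : ℕ) : Set where
  constructor _,_
  field
    <stage : x < stage p
    isBit  : Bit x p

open Elem

shift-suc : ∀ x m → shift (suc x) m ≡ shift x (index m)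
shift-suc zero    m = refl
shift-suc (suc x) m = cong index (shift-suc x m)

module _ (em : ExcludedMiddle 0ℓ) where

  decide : (P : Set) → ∃ λ b → (¬ bit b ≡ 0) ⇔ P
  decide P with em {P}
  ... | yes p = true , mk⇔ (λ _ → p) (λ _ ())
  ... | no ¬p = false , mk⇔ (λ h → contradiction refl h) (λ p → contradiction p ¬p)

  -- The binary digits of the code are chosen one by one, excluded middle deciding each.
  bits-onto : ∀ n (P : ℕ → Set) → ∃ λ m → ∀ x → x < n → (¬ parity (shift x m) ≡ 0) ⇔ P x
  bits-onto zero    P = 0 , λ _ ()
  bits-onto (suc n) P with decide (P 0) | bits-onto n (P ∘ suc)
  ... | b , iff | m , h with k , eq ← halve-onto b m = k , λ
    { zero    _         → subst (λ a → (¬ bit a ≡ 0) ⇔ P 0) (sym (cong proj₁ eq)) iff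
    ; (suc x) (s≤s x<n) → subst (λ a → (¬ parity a ≡ 0) ⇔ P (suc x))
        (sym (trans (shift-suc x k) (cong (shift x ∘ proj₂) eq))) (h x x<n) }

  element : ∀ b j (P : ℕ → Set) → ∃ λ p → tag p ≡ bit b × stage p ≡ j ×
            (∀ x → x < stage p → Elem p x ⇔ P x)
  element b j P with m , h ← bits-onto j P with n , eqn ← halve-onto b m
    with p , eqp ← unpair-onto n j =
    p , cong bit (trans (cong (proj₁ ∘ halve ∘ proj₁) eqp) (cong proj₁ eqn)) , cong proj₂ eqp ,
    λ x x<p →
      let x<j = subst (x <_) (cong proj₂ eqp) x<p
          eq = trans (cong (index ∘ proj₁) eqp) (cong proj₂ eqn)
          iff = subst (λ a → (¬ parity (shift x a) ≡ 0) ⇔ P x) (sym eq) (h x x<j)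
      in mk⇔ (⇒ iff ∘ isBit) (λ Px → x<p , ⇐ iff Px)

-- Formulas defining the order and the preimages of basic sets

pattern v0 = var zero
pattern v1 = var (suc zero)
pattern v2 = var (suc (suc zero))
pattern v3 = var (suc (suc (suc zero)))
pattern v4 = var (suc (suc (suc (suc zero))))

stageᵉ tagᵉ setᵉ : ∀ {n} → Expr n → Expr n
stageᵉ p = app sndᵘ p
tagᵉ p   = app parityᵘ (app fstᵘ p)
setᵉ p   = app indexᵘ (app fstᵘ p)

bitᶠ : ∀ {n} → Expr n → Expr n → Formula n
bitᶠ x p = ¬ᶠ zeroᶠ (app parityᵘ (shiftᵉ x (setᵉ p)))

-- Outside all quantifiers, `v2` and `v1` are the first and the second argument and `v0` is the
-- number searched for. The clauses of `precedesᶠ` correspond to the fields of `Precedes`, in the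
-- same order.
precedesᶠ toᶠ fromᶠ : Formula 3
precedesᶠ =
  stageᵉ v2 <ᶠ stageᵉ v1 ∧ᶠ
  ∀< (stageᵉ v2) (bitᶠ v0 v3 ⇒ᶠ bitᶠ v0 v2) ∧ᶠ
  ∃< (stageᵉ v1) (bitᶠ v0 v2 ∧ᶠ
    ∀< (stageᵉ v3) (bitᶠ v0 v4 ⇒ᶠ belowᶠ (stageᵉ v3) v0 v1)) ∧ᶠ
  ∀< (stageᵉ v2) (bitᶠ v0 v3 ⇒ᶠ
    ∀< (stageᵉ v2) (belowᶠ (stageᵉ v3) v0 v1 ⇒ᶠ bitᶠ v0 v3)) ∧ᶠ
  (zeroᶠ (tagᵉ v1) ⇒ᶠ zeroᶠ (tagᵉ v2) ∧ᶠ
    ∀< (stageᵉ v1) (bitᶠ v0 v2 ⇒ᶠ ¬ᶠ hitᶠ (stageᵉ v2) v0)) ∧ᶠ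
  (¬ᶠ zeroᶠ (tagᵉ v1) ⇒ᶠ ¬ᶠ zeroᶠ (tagᵉ v2) ∧ᶠ
    ∃< (stageᵉ v2) (bitᶠ v0 v3 ∧ᶠ hitᶠ (stageᵉ v2) v0))
toᶠ =
  app indexᵘ v2 <ᶠ stageᵉ v1 ∧ᶠ bitᶠ (app indexᵘ v2) v1 ∧ᶠ
  (¬ᶠ zeroᶠ (app parityᵘ v2) ⇒ᶠ zeroᶠ (tagᵉ v1))
-- The index of the second argument is seen at stage `v0` to be above the whole finite set, so every
-- ideal containing that index contains the set.
fromᶠ =
  ∀< (stageᵉ v2) (bitᶠ v0 v3 ⇒ᶠ belowᶠ v1 v0 (app indexᵘ v2)) ∧ᶠ
  (zeroᶠ (tagᵉ v2) ⇒ᶠ ¬ᶠ zeroᶠ (app parityᵘ v1)) ∧ᶠ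
  (¬ᶠ zeroᶠ (tagᵉ v2) ⇒ᶠ ∃< (stageᵉ v2) (bitᶠ v0 v3 ∧ᶠ hitᶠ v1 v0))

-- The relation `⊏` and its transitivity

module Adjunction (em : ExcludedMiddle 0ℓ) (e u : Code) (≺-trans : Transitive (W₂ e)) where

  private
    _≺_ : Rel ℕ 0ℓ
    _≺_ = W₂ e

    U : Pred ℕ 0ℓ
    U = W₁ u

    open Semantics (semantics e u)

  Avoids : Pred (Ideal _≺_) 0ℓ
  Avoids = Avoiding _≺_ u

  below-≺ : ∀ {j x y} → Below j x y → x ≺ y
  below-≺ = Within-sound e u false

  ≺-below : ∀ {x y} → x ≺ y → Eventually λ j → Below j x y
  ≺-below = Within-complete e u false

  hit-U : ∀ {j x} → Hit j x → x ∈ U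
  hit-U = Within-sound e u true

  U-hit : ∀ {x} → x ∈ U → Eventually λ j → Hit j x
  U-hit = Within-complete e u true

  code : Code
  code = semi precedesᶠ e u

  _⊏_ : Rel ℕ 0ℓ
  _⊏_ = W₂ code

  record Precedes (p q : ℕ) : Set where
    field
      stage<  : stage p < stage q
      subset  : ∀ {x} → Elem p x → Elem q x
      bound   : ∃ λ g → Elem q g × (∀ {f} → Elem p f → Below (stage q) f g)
      closed  : ∀ {x f} → Elem p f → x < stage q → Below (stage q) x f → Elem q x
      avoids  : tag q ≡ 0 → tag p ≡ 0 × (∀ {x} → Elem q x → ¬ Hit (stage q) x)
      hits    : ¬ tag q ≡ 0 → ¬ tag p ≡ 0 × ∃ λ x → Elem p x × Hit (stage q) x

  open Precedes

  ⊏⇔precedes : ∀ p q → p ⊏ q ⇔ Precedes p q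
  ⊏⇔precedes p q = mk⇔
    (λ h → let _ , lt , sub , (g , g<q , g∈q , above) , cl , av , hi = ⇒ iff h in record
      { stage< = lt
      ; subset = λ (x<p , x∈p) → <-trans x<p lt , sub _ x<p x∈p
      ; bound  = g , (g<q , g∈q) , λ (f<p , f∈p) → above _ f<p f∈p
      ; closed = λ (f<p , f∈p) x<q x≺f → x<q , cl _ f<p f∈p _ x<q x≺f
      ; avoids = λ t → let s , a = av t in s , λ (x<q , x∈q) → a _ x<q x∈q
      ; hits   = λ t → let s , x , x<p , x∈p , x∈U = hi t in s , x , (x<p , x∈p) , x∈U
      })
    (λ h → let g , (g<q , g∈q) , above = bound h in ⇐ iff
      -- The formula is independent of the number searched for, so 0 serves as a witness.
      ( 0 , stage< h
      , (λ x x<p x∈p → isBit (subset h (x<p , x∈p)))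
      , (g , g<q , g∈q , λ f f<p f∈p → above (f<p , f∈p))
      , (λ f f<p f∈p x x<q x≺f → isBit (closed h (f<p , f∈p) x<q x≺f))
      , (λ t → let s , a = avoids h t in s , λ x x<q x∈q → a (x<q , x∈q))
      , (λ t → let s , x , (x<p , x∈p) , x∈U = hits h t in s , x , x<p , x∈p , x∈U)
      ))
    where
    iff = semi-correct e u precedesᶠ p q

  ⊏-trans : Transitive _⊏_
  ⊏-trans {p} {q} {r} p⊏q q⊏r = ⇐ (⊏⇔precedes p r) record
    { stage< = <-trans (stage< P) (stage< Q)
    ; subset = subset Q ∘ subset P
    ; bound  = let g , g∈r , above = bound Q in g , g∈r , above ∘ subset P
    ; closed = λ f∈p → closed Q (subset P f∈p)
    ; avoids = map₁ (proj₁ ∘ avoids P) ∘ avoids Q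
    ; hits   = λ t → let s , x , x∈p , x∈U = hits P (proj₁ (hits Q t))
                     -- What is seen in `U` at the stage of `q` is still seen at the later stage of
                     -- `r`.
                     in s , x , x∈p , Within-mono e u {true} (<⇒≤ (stage< Q)) x∈U
    }
    where
    P = ⇒ (⊏⇔precedes p q) p⊏q
    Q = ⇒ (⊏⇔precedes q r) q⊏r

  -- Repeated use of directedness, starting from any element of the ideal; excluded middle decides
  -- which numbers have to be bounded.
  above-finite : ∀ (I : Ideal _≺_) n → ∃ λ c → c ∈ Member I × (∀ f → f < n → f ∈ Member I → f ≺ c)
  above-finite I zero    = let c , c∈I = Ideal.nonempty I in c , c∈I , λ _ ()
  above-finite I (suc n) with above-finite I n | em {n ∈ Member I}
  ... | c , c∈I , h | no n∉I =
    c , c∈I , <suc-elim h λ n∈I → contradiction n∈I n∉I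
  ... | c , c∈I , h | yes n∈I with d , d∈I , n≺d , c≺d ← Ideal.directed I n∈I c∈I =
    d , d∈I , <suc-elim (λ f f<n f∈I → ≺-trans (h f f<n f∈I) c≺d) (const n≺d)

  eventually-hits : ∀ p → (¬ tag p ≡ 0 → ∃ λ x → Elem p x × x ∈ U) →
                    Eventually λ k → ¬ tag p ≡ 0 → ∃ λ x → Elem p x × Hit k x
  eventually-hits p hit with tag p ≟ 0
  ... | yes t = 0 , λ _ _ s → contradiction t s
  ... | no s  = let x , x∈p , x∈U = hit s in mapₑ (λ h _ → x , x∈p , h) (U-hit x∈U)

  -- From ideals of `≺` to ideals of `⊏`

  module From (I : Ideal _≺_) where

    eventually-below : ∀ p c → (∀ f → f < stage p → f ∈ Member I → f ≺ c) →
                       Eventually λ k → ∀ f → f < stage p → f ∈ Member I → Below k f c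
    eventually-below p c above = eventually-∀< {λ f k → f ∈ Member I → Below k f c} (stage p) below
      where
      below : ∀ f → f < stage p → Eventually λ k → f ∈ Member I → Below k f c
      below f f<p with em {f ∈ Member I}
      ... | yes f∈I = mapₑ const (≺-below (above f f<p f∈I))
      ... | no f∉I  = 0 , λ _ _ f∈I → contradiction f∈I f∉I

    -- For a nonzero tag the element of `U` must lie in the set of `p` itself, as `hits` demands of
    -- whatever precedes a number with such a tag.
    Approximates : Pred ℕ 0ℓ
    Approximates p = (∀ {x} → Elem p x → x ∈ Member I) × (tag p ≡ 0 → I ∈ Avoids) ×
                     (¬ tag p ≡ 0 → ∃ λ x → Elem p x × x ∈ U)

    Full : Pred ℕ 0ℓ
    Full p = ∀ {x} → x < stage p → x ∈ Member I → Elem p x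

    full-approximation : ∀ n → ∃ λ q → q ∈ Approximates × Full q × n ≤ stage q
    full-approximation n with em {∃ λ x → x ∈ U × x ∈ Member I}
    ... | no avoid with q , t , s , h ← element em false n (Member I) =
      q , ( (λ x∈q → ⇒ (h _ (<stage x∈q)) x∈q) , (λ _ x x∈U x∈I → avoid (x , x∈U , x∈I))
          , contradiction t ) , (λ x<q → ⇐ (h _ x<q)) , ≤-reflexive (sym s)
    -- The stage exceeds `x`, so that the witness `x` counts as an element of the coded set.
    ... | yes (x , x∈U , x∈I) with q , t , s , h ← element em true (n ⊔ suc x) (Member I) =
      q , ( (λ x∈q → ⇒ (h _ (<stage x∈q)) x∈q) , (λ t′ → contradiction (trans (sym t) t′) λ ())
          , (λ _ → x , ⇐ (h x (subst (x <_) (sym s) (m≤n⊔m n (suc x)))) x∈I , x∈U) )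
        , (λ x<q → ⇐ (h _ x<q)) , subst (n ≤_) (sym s) (m≤m⊔n n (suc x))

    -- The ideal cannot both avoid `U` and contain an element of it.
    same-tag : ∀ {p q} → p ∈ Approximates → q ∈ Approximates → tag q ≡ 0 → tag p ≡ 0
    same-tag {p} (p⊆I , _ , hit) (_ , avoid , _) t = decidable-stable (tag p ≟ 0) λ s →
      let x , x∈p , x∈U = hit s in avoid t x x∈U (p⊆I x∈p)

    -- Fullness puts an upper bound `c` of `p`, and everything seen below `p`, into `q`. Beyond
    -- that, only finitely many computations must have halted by the stage of `q`.
    extend : ∀ {p} → p ∈ Approximates →
             Eventually λ k → ∀ q → q ∈ Approximates → Full q → stage q ≡ k → p ⊏ q
    extend {p} A@(p⊆I , avoid , _) =
      let c , c∈I , above = above-finite I (stage p) in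
      mapₑ (λ { (p<q , c<q , below , hit) q B full refl → ⇐ (⊏⇔precedes p q) record
        { stage< = p<q
        ; subset = λ x∈p → full (<-trans (<stage x∈p) p<q) (p⊆I x∈p)
        ; bound  = c , full c<q c∈I , λ f∈p → below _ (<stage f∈p) (p⊆I f∈p)
        ; closed = λ f∈p x<q x≺f → full x<q (Ideal.lower I (below-≺ x≺f) (p⊆I f∈p))
        ; avoids = λ t → same-tag A B t ,
                         λ x∈q x∈U → proj₁ (proj₂ B) t _ (hit-U x∈U) (proj₁ B x∈q)
        ; hits   = λ t → let s = t ∘ same-tag B A in s , hit s
        } })
      (eventually-≥ (suc (stage p)) ∩ₑ eventually-≥ (suc c) ∩ₑ
       eventually-below p c above ∩ₑ eventually-hits p (proj₂ (proj₂ A)))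

    ideal : Ideal _⊏_
    ideal = record
      { Member   = Approximates
      ; nonempty = let q , A , _ = full-approximation 0 in q , A
      ; lower    = λ {q} {p} p⊏q (q⊆I , avoid , hit) → let P = ⇒ (⊏⇔precedes p q) p⊏q in
          q⊆I ∘ subset P ,
          (λ t → avoid (decidable-stable (tag q ≟ 0) λ s → proj₁ (hits P s) t)) ,
          (λ s → let x , x∈p , h = proj₂ (hits P (s ∘ proj₁ ∘ avoids P)) in x , x∈p , hit-U h)
      ; directed = λ {p} {q} A B →
          let K , h = extend A ∩ₑ extend B
              r , C , full , K≤r = full-approximation K
          in r , C , proj₁ (h _ K≤r) r C full refl , proj₂ (h _ K≤r) r C full refl
      }

  -- From ideals of `⊏` to ideals of `≺`, and back

  module To (J : Ideal _⊏_) where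

    Union : Pred ℕ 0ℓ
    Union x = ∃ λ p → p ∈ Member J × Elem p x

    precedes : ∀ {p q} → p ⊏ q → Precedes p q
    precedes = ⇒ (⊏⇔precedes _ _)

    -- Directedness provides a successor within the ideal, and each `⊏` step raises the stage.
    cofinal : ∀ n {p} → p ∈ Member J → ∃ λ q → q ∈ Member J × p ⊏ q × n ≤ stage q
    cofinal zero    p∈J = let q , q∈J , p⊏q , _ = Ideal.directed J p∈J p∈J in q , q∈J , p⊏q , z≤n
    cofinal (suc n) p∈J =
      let q , q∈J , p⊏q , n≤q = cofinal n p∈J
          r , r∈J , q⊏r , _ = Ideal.directed J q∈J q∈J
      in r , r∈J , ⊏-trans p⊏q q⊏r , ≤-<-trans n≤q (stage< (precedes q⊏r))

    ideal : Ideal _≺_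
    ideal = record
      { Member   = Union
      ; nonempty =
          let p , p∈J = Ideal.nonempty J
              q , q∈J , p⊏q , _ = Ideal.directed J p∈J p∈J
              -- The set of `p` may be empty, but that of `q` contains an upper bound of it.
              g , g∈q , _ = bound (precedes p⊏q)
          in g , q , q∈J , g∈q
      ; lower    = λ {a} {b} b≺a (p , p∈J , a∈p) →
          let K , below = ≺-below b≺a
              -- At this stage `b` is small enough to count and is already seen below `a`.
              q , q∈J , p⊏q , h = cofinal (K ⊔ suc b) p∈J
          in q , q∈J , closed (precedes p⊏q) a∈p (m⊔n≤o⇒n≤o K (suc b) h)
                                                 (below _ (m⊔n≤o⇒m≤o K (suc b) h))
      ; directed = λ (p , p∈J , a∈p) (q , q∈J , b∈q) →
          let r , r∈J , p⊏r , q⊏r = Ideal.directed J p∈J q∈J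
              s , s∈J , r⊏s , _ = Ideal.directed J r∈J r∈J
              g , g∈s , above = bound (precedes r⊏s)
          in g , (s , s∈J , g∈s) , below-≺ (above (subset (precedes p⊏r) a∈p))
                                 , below-≺ (above (subset (precedes q⊏r) b∈q))
      }

    tag-up : ∀ {p q} → p ⊏ q → tag p ≡ 0 → tag q ≡ 0
    tag-up {q = q} p⊏q t = decidable-stable (tag q ≟ 0) λ s → proj₁ (hits (precedes p⊏q) s) t

    -- An element of `U` in the union would belong to some member of `J` with tag 0 whose stage is
    -- late enough to see it enumerated, contradicting `avoids`.
    avoids-of-tag : ∀ {p} → p ∈ Member J → tag p ≡ 0 → ideal ∈ Avoids
    avoids-of-tag p∈J t x x∈U (q , q∈J , x∈q) =
      let r , r∈J , p⊏r , q⊏r = Ideal.directed J p∈J q∈J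
          K , hit = U-hit x∈U
          s , s∈J , r⊏s , K≤s = cofinal K r∈J
          R = precedes r⊏s
      in proj₂ (avoids R (tag-up r⊏s (tag-up p⊏r t)))
               (subset R (subset (precedes q⊏r) x∈q)) (hit _ K≤s)

    hits-of-tag : ∀ {p} → p ∈ Member J → ¬ tag p ≡ 0 → ∃ λ x → Elem p x × x ∈ U
    hits-of-tag p∈J s =
      let q , q∈J , p⊏q , _ = Ideal.directed J p∈J p∈J
          x , x∈p , h = proj₂ (hits (precedes p⊏q) (s ∘ proj₁ ∘ avoids (precedes p⊏q)))
      in x , x∈p , hit-U h

    tag-of-avoids : ∀ {p} → p ∈ Member J → ideal ∈ Avoids → tag p ≡ 0
    tag-of-avoids {p} p∈J avoid = decidable-stable (tag p ≟ 0) λ s →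
      let x , x∈p , x∈U = hits-of-tag p∈J s in avoid x x∈U (p , p∈J , x∈p)

    -- Directedness merges the finitely many members of `J` from which the elements of `p` come.
    finite-union : ∀ n p → (∀ {x} → Elem p x → x ∈ Union) →
                   ∃ λ q → q ∈ Member J × (∀ x → x < n → Elem p x → Elem q x)
    finite-union zero    p p⊆ = let q , q∈J = Ideal.nonempty J in q , q∈J , λ _ ()
    finite-union (suc n) p p⊆ with finite-union n p p⊆ | em {Elem p n}
    ... | q , q∈J , h | no n∉p = 
      q , q∈J , <suc-elim h λ n∈p → contradiction n∈p n∉p
    ... | q , q∈J , h | yes n∈p =
      let r , r∈J , n∈r = p⊆ n∈p
          s , s∈J , q⊏s , r⊏s = Ideal.directed J q∈J r∈J
      in s , s∈J , <suc-elim (λ x x<n x∈p → subset (precedes q⊏s) (h x x<n x∈p))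
                             (const (subset (precedes r⊏s) n∈r))

    -- For the converse, some `r` in `J` contains the set of `p`, and a late `s` above `r` is above
    -- `p` as well: bound and closure conditions pass to subsets, and the tags agree because both
    -- tell whether the union avoids `U`.
    member⇔approximates : Member J ≐ From.Approximates ideal
    member⇔approximates =
      (λ {p} p∈J → (λ x∈p → p , p∈J , x∈p) , avoids-of-tag p∈J , hits-of-tag p∈J) , below
      where
      below : ∀ {p} → p ∈ From.Approximates ideal → p ∈ Member J
      below {p} (p⊆ , avoid , hit) =
        let r , r∈J , p⊆r = finite-union (stage p) p p⊆
            K , hit′ = eventually-hits p hit
            s , s∈J , r⊏s , h = cofinal (K ⊔ suc (stage p)) r∈J
            R = precedes r⊏s
            p⊆r′ = λ {x} (x∈p : Elem p x) → p⊆r x (<stage x∈p) x∈p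
        in Ideal.lower J (⇐ (⊏⇔precedes p s) record
             { stage< = m⊔n≤o⇒n≤o K _ h
             ; subset = λ x∈p → subset R (p⊆r′ x∈p)
             ; bound  = let g , g∈s , above = bound R in g , g∈s , λ f∈p → above (p⊆r′ f∈p)
             ; closed = λ f∈p → closed R (p⊆r′ f∈p)
             ; avoids = λ t → tag-zero (avoids-of-tag s∈J t) , proj₂ (avoids R t)
             ; hits   = λ t → let t′ = t ∘ tag-of-avoids s∈J ∘ avoid
                             in t′ , hit′ _ (m⊔n≤o⇒m≤o K _ h) t′
             }) s∈J
        where
        tag-zero : ideal ∈ Avoids → tag p ≡ 0
        tag-zero avoid′ = decidable-stable (tag p ≟ 0) λ t →
          let x , x∈p , x∈U = hit t in avoid′ x x∈U (p⊆ x∈p)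

  -- The computable homeomorphism

  union-approximates : ∀ I → Member (To.ideal (From.ideal I)) ≐ Member I
  union-approximates I =
    (λ (p , A , x∈p) → proj₁ A x∈p) ,
    (λ {x} x∈I → let q , A , full , x<q = From.full-approximation I (suc x) in q , A , full x<q x∈I)

  To-cong : ∀ J J′ → Member J ≐ Member J′ → Member (To.ideal J) ≐ Member (To.ideal J′)
  To-cong J J′ (f , g) = map₂ (map₁ f) , map₂ (map₁ g)

  From-mono : ∀ I I′ → Member I ≐ Member I′ →
              ∀ {p} → p ∈ From.Approximates I → p ∈ From.Approximates I′
  From-mono I I′ eq (p⊆I , avoid , hit) =
    proj₁ eq ∘ p⊆I , Avoiding-resp _≺_ u I I′ eq ∘ avoid , hit

  X Y : EffectiveSpace
  X = idealSpace code
  Y = adjoin (idealSpace e) Avoids (Avoiding-resp _≺_ u)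

  bijection : Inverse (EffectiveSpace.points X) (EffectiveSpace.points Y)
  bijection = record
    { to        = To.ideal
    ; from      = From.ideal
    ; to-cong   = λ {J} {J′} → To-cong J J′
    ; from-cong = λ {I} {I′} eq → From-mono I I′ eq , From-mono I′ I (swap eq)
    ; inverse   =
        (λ {I} {J} eq →
          let f , g = To-cong J (From.ideal I) eq
              f′ , g′ = union-approximates I
          in f′ ∘ f , g ∘ g′) ,
        (λ {J} {I} eq →
          let f , g = To.member⇔approximates J
          in g ∘ From-mono I (To.ideal J) eq , From-mono (To.ideal J) I (swap eq) ∘ f)
    }

  adjoinBase⇔ : ∀ n I → I ∈ EffectiveSpace.Base Y n ⇔
                (index n ∈ Member I × (¬ parity n ≡ 0 → I ∈ Avoids))
  adjoinBase⇔ n I with halve n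
  ... | false , m = mk⇔ (λ m∈I → m∈I , contradiction refl) proj₁
  ... | true  , m = mk⇔ (λ (avoid , m∈I) → m∈I , const avoid) (λ (m∈I , avoid) → avoid (λ ()) , m∈I)

  to-computable : Computable X Y To.ideal
  to-computable = semi toᶠ e u , λ n →
    (λ {J} h → let (p , p∈J , n<p , n∈p) , avoid = ⇒ (adjoinBase⇔ n (To.ideal J)) h in
      p , ⇐ (semi-correct e u toᶠ n p)
            (0 , n<p , n∈p , λ s → To.tag-of-avoids J p∈J (avoid s)) , p∈J) ,
    (λ {J} (p , h , p∈J) → let _ , n<p , n∈p , t = ⇒ (semi-correct e u toᶠ n p) h in
      ⇐ (adjoinBase⇔ n (To.ideal J)) ((p , p∈J , n<p , n∈p) , λ s → To.avoids-of-tag J p∈J (t s)))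

  -- Odd basic sets are those intersected with the added open set, so `k` is chosen odd exactly if
  -- the tag of `p` is 0.
  basic-neighbourhood : ∀ I {p c} → p ∈ From.Approximates I → c ∈ Member I →
    ∃ λ k → index k ≡ c × I ∈ EffectiveSpace.Base Y k × (tag p ≡ 0 → ¬ parity k ≡ 0)
  basic-neighbourhood I {p} {c} (_ , avoid , _) c∈I with tag p ≟ 0
  ... | yes t with k , eq ← halve-onto true c =
    k , cong proj₂ eq ,
    ⇐ (adjoinBase⇔ k I) (subst (_∈ Member I) (sym (cong proj₂ eq)) c∈I , const (avoid t)) ,
    λ _ s → contradiction (trans (sym (cong (bit ∘ proj₁) eq)) s) λ ()
  ... | no s with k , eq ← halve-onto false c =
    k , cong proj₂ eq ,
    ⇐ (adjoinBase⇔ k I) (subst (_∈ Member I) (sym (cong proj₂ eq)) c∈I ,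
                          contradiction (cong (bit ∘ proj₁) eq)) ,
    λ t → contradiction t s

  -- An ideal approximated by `p` contains some `c` above the finite set of `p`. The neighbourhood
  -- given by `c` and the tag stays in the preimage, since ideals are lower sets.
  from-computable : Computable Y X From.ideal
  from-computable = semi fromᶠ e u , λ p →
    (λ {I} A →
      let c , c∈I , above = above-finite I (stage p)
          k , eq , I∈k , odd = basic-neighbourhood I A c∈I
          K , witness = From.eventually-below I p c above ∩ₑ eventually-hits p (proj₂ (proj₂ A))
          below , hit = witness K ≤-refl
      in k , ⇐ (semi-correct e u fromᶠ p k)
                ( K , (λ f f<p f∈p → subst (Below K f) (sym eq) (below f f<p (proj₁ A (f<p , f∈p))))
                , odd
                , λ s → let x , (x<p , x∈p) , h = hit s in x , x<p , x∈p , h) , I∈k) ,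
    (λ {I} (k , h , I∈k) →
      let j , below , odd , hit = ⇒ (semi-correct e u fromᶠ p k) h
          k∈I , avoid = ⇒ (adjoinBase⇔ k I) I∈k
      in (λ (f<p , f∈p) → Ideal.lower I (below-≺ (below _ f<p f∈p)) k∈I) , avoid ∘ odd ,
         λ s → let x , x<p , x∈p , x∈U = hit s in x , (x<p , x∈p) , hit-U x∈U)

  homeomorphism : ComputableHomeomorphism X Y
  homeomorphism = record
    { bijection       = bijection
    ; to-computable   = to-computable
    ; from-computable = from-computable
    }

theorem4 :
    ExcludedMiddle 0ℓ →
    Σ[ f ∈ (Code → Code → Code) ]
      Computable₂ f ×
      (∀ (e u : Code) → Transitive (W₂ e) →
        Transitive (W₂ (f e u)) ×
        ComputableHomeomorphism
          (idealSpace (f e u))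
          (adjoin (idealSpace e) (Avoiding (W₂ e) u) (Avoiding-resp (W₂ e) u)))
theorem4 em = semi precedesᶠ , semi-computable precedesᶠ , λ e u ≺-trans →
  let open Adjunction em e u ≺-trans in ⊏-trans , homeomorphism
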